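{- Let $n$ be a squarefree positive integer such that every prime divisor of $n$ is at least $7$. Suppose $p'$ is a prime divisor of $n$ and $\Omega(n)\neq 2,3$. Then a sequence $T$ in $\mathbb{Z}_n$ is a $D$-extremal sequence for $L(n;p')$ if and only if $T$ is a $D$-extremal sequence for $U(n)$.
   Context: $\mathbb{Z}_n$ denotes the ring $\mathbb{Z}/n\mathbb{Z}$ and $U(n)$ its group of units. For odd $n$ and $x\in U(n)$, $\left(\frac{x}{n}\right)$ denotes the Jacobi symbol. For a prime divisor $p$ of $n$, $L(n;p)=\{a\in U(n):\left(\frac{a}{n}\right)=\left(\frac{a}{p}\right)\}$. For squarefree $n$, $\Omega(n)$ is the number of prime divisors of $n$. For $A\subseteq\mathbb{Z}_n$, a (nonempty, finite) sequence $(y_1,\ldots,y_k)$ in $\mathbb{Z}_n$ is an $A$-weighted zero-sum sequence if there exist $a_1,\ldots,a_k\in A$ with $a_1y_1+\cdots+a_ky_k=0$. The $A$-weighted Davenport constant $D_A(n)$ is the least positive integer $k$ such that every sequence of length $k$ in $\mathbb{Z}_n$ has a (nonempty) subsequence, not necessarily of consecutive terms, that is an $A$-weighted zero-sum sequence. If $0\notin A$, a $D$-extremal sequence for $A$ is a sequence in $\mathbb{Z}_n$ of length $D_A(n)-1$ which has no $A$-weighted zero-sum subsequence. -}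

module Defs where

open import Algebra.Definitions using (Invertible)
open import Data.Bool.Base using (if_then_else_)
open import Data.Fin.Base using (Fin; toℕ)
open import Data.Fin.Properties using (any?)
open import Data.Integer.Base as ℤ using (ℤ; 0ℤ; 1ℤ; -1ℤ)
open import Data.List.Base using (List; []; length; map; foldr; zipWith)
open import Data.List.Relation.Binary.Sublist.Propositional using (_⊆_)
open import Data.List.Relation.Unary.All using (All)
open import Data.Nat.Base using (ℕ; NonZero; _+_; _*_; _∸_; _≤_; ∣_-_∣)
open import Data.Nat.DivMod using (_mod_)
open import Data.Nat.Divisibility using (_∣_; _∣?_)
open import Data.Nat.Primality.Factorisation using (factorise; factors)
open import Data.Product.Base using (∃-syntax; _×_)
open import Level using (0ℓ)
open import Relation.Binary.PropositionalEquality.Core using (_≡_; _≢_)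
open import Relation.Nullary.Decidable.Core using (Dec; does)
open import Relation.Nullary.Negation.Core using (¬_)
open import Relation.Unary using (Pred)

Squarefree : ℕ → Set
Squarefree n = ∀ d → d * d ∣ n → d ≡ 1

-- Counted with multiplicity; for squarefree n this is the number of
-- prime divisors of n.
Ω : (n : ℕ) .{{_ : NonZero n}} → ℕ
Ω n = length (factors (factorise n))

IsSquareMod : ℕ → ℕ → Set
IsSquareMod p a = ∃[ x ] p ∣ ∣ toℕ {p} x * toℕ x - a ∣

isSquareMod? : ∀ p a → Dec (IsSquareMod p a)
isSquareMod? p a = any? λ x → p ∣? ∣ toℕ x * toℕ x - a ∣

-- Only meaningful when p is an odd prime.
legendre : ℕ → ℕ → ℤ
legendre a p =
  if does (p ∣? a) then 0ℤ
  else if does (isSquareMod? p a) then 1ℤ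
  else -1ℤ

-- Product over the prime factors of n, with multiplicity; for n prime it
-- is the Legendre symbol.
jacobi : ℕ → (n : ℕ) .{{_ : NonZero n}} → ℤ
jacobi a n = foldr ℤ._*_ 1ℤ (map (legendre a) (factors (factorise n)))

-- The ring ℤ/nℤ, on the least nonnegative representatives.

ℤmod : ℕ → Set
ℤmod = Fin

module _ {n : ℕ} .{{_ : NonZero n}} where

  infixl 6 _⊕_
  infixl 7 _⊗_

  𝟘 𝟙 : ℤmod n
  𝟘 = 0 mod n
  𝟙 = 1 mod n

  _⊕_ _⊗_ : ℤmod n → ℤmod n → ℤmod n
  a ⊕ b = (toℕ a + toℕ b) mod n
  a ⊗ b = (toℕ a * toℕ b) mod n

  weightedSum : List (ℤmod n) → List (ℤmod n) → ℤmod n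
  weightedSum as ys = foldr _⊕_ 𝟘 (zipWith _⊗_ as ys)

U : (n : ℕ) .{{_ : NonZero n}} → Pred (ℤmod n) 0ℓ
U n = Invertible _≡_ 𝟙 _⊗_

-- As p is a prime divisor of n, the symbol of a modulo p may be computed
-- from the representative of a modulo n.
L : (n : ℕ) .{{_ : NonZero n}} → ℕ → Pred (ℤmod n) 0ℓ
L n p a = U n a × jacobi (toℕ a) n ≡ legendre (toℕ a) p

module _ {n : ℕ} .{{_ : NonZero n}} (A : Pred (ℤmod n) 0ℓ) where

  IsZeroSum : List (ℤmod n) → Set
  IsZeroSum ys =
    ys ≢ [] ×
    ∃[ as ] length as ≡ length ys × All A as × weightedSum as ys ≡ 𝟘

  HasZeroSumSubsequence : List (ℤmod n) → Set
  HasZeroSumSubsequence T = ∃[ ys ] ys ⊆ T × IsZeroSum ys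

  EveryHasZeroSum : ℕ → Set
  EveryHasZeroSum k =
    ∀ (T : List (ℤmod n)) → length T ≡ k → HasZeroSumSubsequence T

  -- The Davenport constant of A, as a relation: k is the least positive
  -- integer with the defining property.
  record IsDavenportConstant (k : ℕ) : Set where
    field
      positive : 1 ≤ k
      forces   : EveryHasZeroSum k
      least    : ∀ j → 1 ≤ j → EveryHasZeroSum j → k ≤ j

  -- Intended for A not containing 𝟘.
  IsDExtremal : List (ℤmod n) → Set
  IsDExtremal T =
    ∃[ k ] IsDavenportConstant k × length T ≡ k ∸ 1 × ¬ HasZeroSumSubsequence T

{-# OPTIONS --safe #-}

-- Modulo a prime q ≥ 7 a sequence has a unit-weighted zero-sum unless exactly
-- one term is nonzero mod q. With no nonzero term, or at least three, the
-- quadratic characters of the weights may even be prescribed, since a u + b v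
-- = d ≠ 0 is solvable with prescribed characters of a and b; with exactly two,
-- i and j, they may be prescribed off j. A U-weighted zero-sum subsequence is
-- L-weighted after correcting, at primes q ≠ p′, the product of the characters
-- of each weight. This can fail only if all q ≠ p′ see the same two nonzero
-- terms, and then, in a sequence of length at least 4, a further term can be
-- brought in (or the terms divisible by all q ≠ p′ already give a zero-sum).
-- For Ω(n) ≥ 4 the idempotents of four prime components form a sequence
-- without U-weighted zero-sum, so both Davenport constants exceed 4 and only
-- lengths ≥ 4 matter. For Ω(n) = 1, L(n;p′) = U(n).
module Submission where

open import Defs
import Algebra.Properties.CommutativeSemigroup as CommutativeSemigroup
import Algebra.Properties.Monoid.Sum as Sum
open import Data.Bool.Base as Bool using (Bool; true; false; if_then_else_)
open import Data.Fin.Base as Fin using (Fin; zero; suc; toℕ; fromℕ<)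
open import Data.Fin.Properties as Fin using (any?; injective⇒≤; toℕ<n; toℕ-fromℕ<; toℕ-injective; ¬∀⟶∃¬-smallest; combine-remQuot; toℕ-inject)
open import Data.Integer.Base as ℤ using (ℤ; +_; -[1+_]; 0ℤ; 1ℤ; -1ℤ; _+_; _*_; _-_; -_) renaming (∣_∣ to abs)
open import Data.Integer.Divisibility.Signed using (divides; ∣ᵤ⇒∣; ∣⇒∣ᵤ; ∣-trans; ∣m∣n⇒∣m+n; ∣m∣n⇒∣m-n; ∣m⇒∣-m; ∣n⇒∣m*n; ∣m⇒∣m*n; _∣?_) renaming (_∣_ to _∣ᶻ_)
open import Data.Integer.DivMod using (_%ℕ_; _/ℕ_; n%ℕd<d; a≡a%ℕn+[a/ℕn]*n)
import Data.Integer.Properties as ℤ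
open import Data.Integer.Tactic.RingSolver using (solve-∀)
open import Data.List.Base using (List; []; _∷_; foldr; length; lookup; map; take)
open import Data.List.Membership.Propositional using (_∈_; find; lose)
open import Data.List.Membership.Propositional.Properties using (∈-lookup; ∈-++⁺ˡ)
open import Data.List.Properties using (length-take)
open import Data.List.Relation.Binary.Sublist.Propositional using (_⊆_; []; _∷_; _∷ʳ_; ⊆-trans)
open import Data.List.Relation.Binary.Sublist.Propositional.Properties using (take-⊆)
open import Data.List.Relation.Unary.All as All using (All; []; _∷_)
open import Data.List.Relation.Unary.AllPairs using ([]; _∷_)
open import Data.List.Relation.Unary.Any as Any using (here; there)
open import Data.List.Relation.Unary.Unique.Propositional using (Unique)
open import Data.List.Relation.Unary.Unique.Propositional.Properties using (take⁺)
open import Data.Nat.Base as ℕ using (ℕ; zero; suc; NonZero; _≤_; _<_; z≤n; s≤s)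
open import Data.Nat.Coprimality using (Coprime; coprime-Bézout)
open import Data.Nat.DivMod using (_%_; _/_; _mod_; m%n<n; m≡m%n+[m/n]*n; /-monoˡ-≤)
open import Data.Nat.Divisibility as ℕ using (_∣_)
open import Data.Nat.GCD using (module Bézout)
open import Data.Nat.ListAction using (product)
open import Data.Nat.ListAction.Properties using (∈⇒∣product)
open import Data.Nat.Primality using (Prime; ¬prime[1]; prime⇒nonZero; prime⇒nonTrivial; prime⇒irreducible; euclidsLemma)
open import Data.Nat.Primality.Factorisation using (factorise; factors; PrimeFactorisation; factorisationHasAllPrimeFactors)
import Data.Nat.Properties as ℕ
open import Data.Product.Base using (∃; ∃-syntax; ∃₂; _×_; _,_; proj₁; proj₂)
open import Data.Sign.Base as Sign using (Sign)
import Data.Sign.Properties as Sign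
open import Data.Sum.Base using (_⊎_; inj₁; inj₂; [_,_]′)
open import Data.Unit.Base using (tt)
open import Data.Vec.Functional using (Vector; updateAt)
open import Data.Vec.Functional.Properties using (updateAt-updates; updateAt-minimal)
open import Function.Base using (_∘_; _$_; const; id)
open import Function.Bundles using (_⇔_; mk⇔)
open import Level using (0ℓ)
open import Relation.Binary.Bundles using (Setoid)
open import Relation.Binary.PropositionalEquality
import Relation.Binary.Reasoning.Setoid as SetoidReasoning
open import Relation.Nullary.Decidable using (Dec; yes; no; does; ⌊_⌋; map′; decidable-stable; ¬?; _×-dec_; _⊎-dec_; dec-true; dec-false; toWitness; fromWitness)
open import Relation.Nullary.Negation using (¬_; contradiction)
open import Relation.Unary using (Pred)

open import Data.List.Membership.DecPropositional ℕ._≟_ using (_∈?_)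
open CommutativeSemigroup Sign.*-commutativeSemigroup using (xy∙z≈zy∙x)
open Sum ℤ.+-0-monoid using (sum)

-- A unit weight lies in L(n;p′) exactly when its characters at the primes q ≠ p′ multiply to +1:
-- one condition per weight, which a change at a single such q repairs. The obstacle is a ratio of
-- weights forced at all these primes at once, and it shows why length 4 is asked for. Suppose some
-- q ≠ p′ divides n, let c be a unit whose characters at the q ≠ p′ multiply to -1, and let e be the
-- idempotent of p′. In (1, -c, e) the first two terms are a U-weighted zero-sum, yet no subsequence
-- is an L-weighted one, since every q ≠ p′ forces the first two weights to have ratio c. A fourth
-- term breaks this. Neither Davenport constant is computed; it is enough that the two weight sets
-- are interchangeable on sequences of length at least 4 and that no shorter length matters.

∣-resp : ∀ {k x y} → x ≡ y → k ∣ᶻ x → k ∣ᶻ y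
∣-resp {k} = subst (k ∣ᶻ_)

pos-*+ : ∀ a b c → + (a ℕ.* b ℕ.+ c) ≡ + a * + b + + c
pos-*+ a b c = trans (ℤ.pos-+ (a ℕ.* b) c) (cong (_+ + c) (ℤ.pos-* a b))

-- Congruences

infix 4 _≅_[_]

-- A record, so that x and y are recovered by unification.
record _≅_[_] (x y : ℤ) (n : ℕ) : Set where
  constructor cong-mod
  field ∣-difference : + n ∣ᶻ x - y

open _≅_[_]

module _ {n : ℕ} where

  ≅-by : ∀ {x y z} → z ≡ x - y → + n ∣ᶻ z → x ≅ y [ n ]
  ≅-by eq d = cong-mod (∣-resp eq d)

  ≅-reflexive : ∀ {x y} → x ≡ y → x ≅ y [ n ]
  ≅-reflexive {x} {y} eq = cong-mod (divides 0ℤ (ℤ.i≡j⇒i-j≡0 eq))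

  ≅-sym : ∀ {x y} → x ≅ y [ n ] → y ≅ x [ n ]
  ≅-sym {x} {y} (cong-mod d) = ≅-by (ring x y) (∣m⇒∣-m d)
    where
    ring : ∀ x y → - (x - y) ≡ y - x
    ring = solve-∀

  ≅-trans : ∀ {x y z} → x ≅ y [ n ] → y ≅ z [ n ] → x ≅ z [ n ]
  ≅-trans {x} {y} {z} (cong-mod d) (cong-mod e) = ≅-by (ring x y z) (∣m∣n⇒∣m+n d e)
    where
    ring : ∀ x y z → x - y + (y - z) ≡ x - z
    ring = solve-∀

  ≅-+ : ∀ {x y z w} → x ≅ y [ n ] → z ≅ w [ n ] → x + z ≅ y + w [ n ]
  ≅-+ {x} {y} {z} {w} (cong-mod d) (cong-mod e) = ≅-by (ring x y z w) (∣m∣n⇒∣m+n d e)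
    where
    ring : ∀ x y z w → x - y + (z - w) ≡ x + z - (y + w)
    ring = solve-∀

  ≅-neg : ∀ {x y} → x ≅ y [ n ] → - x ≅ - y [ n ]
  ≅-neg {x} {y} (cong-mod d) = ≅-by (ring x y) (∣m⇒∣-m d)
    where
    ring : ∀ x y → - (x - y) ≡ - x - - y
    ring = solve-∀

  ≅-* : ∀ {x y z w} → x ≅ y [ n ] → z ≅ w [ n ] → x * z ≅ y * w [ n ]
  ≅-* {x} {y} {z} {w} (cong-mod d) (cong-mod e) =
    ≅-by (ring x y z w) (∣m∣n⇒∣m+n (∣m⇒∣m*n z d) (∣n⇒∣m*n y e))
    where
    ring : ∀ x y z w → (x - y) * z + y * (z - w) ≡ x * z - y * w
    ring = solve-∀

  ∣-cong : ∀ {x y} → x ≅ y [ n ] → + n ∣ᶻ y → + n ∣ᶻ x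
  ∣-cong {x} {y} (cong-mod d) e = ∣-resp (ring x y) (∣m∣n⇒∣m+n d e)
    where
    ring : ∀ x y → x - y + y ≡ x
    ring = solve-∀

  ∣⇒≅0 : ∀ {x} → + n ∣ᶻ x → x ≅ 0ℤ [ n ]
  ∣⇒≅0 {x} d = ≅-by (sym (ℤ.+-identityʳ x)) d

  ≅0⇒∣ : ∀ {x} → x ≅ 0ℤ [ n ] → + n ∣ᶻ x
  ≅0⇒∣ e = ∣-cong e (divides 0ℤ refl)

≅-setoid : ℕ → Setoid _ _
≅-setoid n = record
  { _≈_ = _≅_[ n ]
  ; isEquivalence = record { refl = ≅-reflexive refl ; sym = ≅-sym ; trans = ≅-trans } }

bézoutℤ : ∀ {m n} → Coprime m n → ∃[ a ] (+ m * a ≅ 1ℤ [ n ])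
bézoutℤ {m} {n} c with coprime-Bézout c
... | Bézout.+- x y eq = + x , cong-mod (divides (+ y) (lemma (+ m) (+ x) (+ y) (+ n)
        (trans (sym (pos-*+ y n 1)) (trans (cong +_ (trans (ℕ.+-comm _ 1) eq)) (ℤ.pos-* x m)))))
  where
  ring : ∀ m x y n → m * x - 1ℤ ≡ (x * m - (y * n + 1ℤ)) + y * n
  ring = solve-∀
  lemma : ∀ m x y n → y * n + 1ℤ ≡ x * m → m * x - 1ℤ ≡ y * n
  lemma m x y n e = trans (ring m x y n)
    (trans (cong (_+ y * n) (ℤ.i≡j⇒i-j≡0 (sym e))) (ℤ.+-identityˡ _))
... | Bézout.-+ x y eq = - + x , cong-mod (divides (- + y) (lemma (+ m) (+ x) (+ y) (+ n)
        (trans (sym (pos-*+ x m 1)) (trans (cong +_ (trans (ℕ.+-comm _ 1) eq)) (ℤ.pos-* y n)))))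
  where
  ring : ∀ m x y n → m * (- x) - 1ℤ ≡ (y * n - (x * m + 1ℤ)) + (- y) * n
  ring = solve-∀
  lemma : ∀ m x y n → x * m + 1ℤ ≡ y * n → m * (- x) - 1ℤ ≡ (- y) * n
  lemma m x y n e = trans (ring m x y n)
    (trans (cong (_+ (- y) * n) (ℤ.i≡j⇒i-j≡0 (sym e))) (ℤ.+-identityˡ _))

%ℕ-≅ : ∀ x n .{{_ : NonZero n}} → + (x %ℕ n) ≅ x [ n ]
%ℕ-≅ x n = cong-mod $ divides (- (x /ℕ n)) (trans (cong (λ z → + (x %ℕ n) - z) (a≡a%ℕn+[a/ℕn]*n x n)) (ring (+ (x %ℕ n)) (x /ℕ n) (+ n)))
  where
  ring : ∀ r q n → r - (r + q * n) ≡ - q * n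
  ring = solve-∀

module _ {q : ℕ} (pr : Prime q) where

  private instance
    q≢0 : NonZero q
    q≢0 = prime⇒nonZero pr

  prime-∣* : ∀ x y → + q ∣ᶻ x * y → + q ∣ᶻ x ⊎ + q ∣ᶻ y
  prime-∣* x y d with euclidsLemma (abs x) (abs y) pr (subst (q ℕ.∣_) (ℤ.abs-* x y) (∣⇒∣ᵤ d))
  ... | inj₁ e = inj₁ (∣ᵤ⇒∣ e)
  ... | inj₂ e = inj₂ (∣ᵤ⇒∣ e)

  ∤-* : ∀ {x y} → ¬ + q ∣ᶻ x → ¬ + q ∣ᶻ y → ¬ + q ∣ᶻ x * y
  ∤-* p r = [ p , r ]′ ∘ prime-∣* _ _

  ∤⇒coprime : ∀ {m} → ¬ q ∣ m → Coprime m q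
  ∤⇒coprime ¬d (d∣m , d∣q) with prime⇒irreducible pr d∣q
  ... | inj₁ eq = eq
  ... | inj₂ refl = contradiction d∣m ¬d

  ∤1 : ¬ + q ∣ᶻ 1ℤ
  ∤1 d = ℕ.<⇒≱ (ℕ.nonTrivial⇒n>1 q {{prime⇒nonTrivial pr}}) (ℕ.∣⇒≤ (∣⇒∣ᵤ d))

  ∤-cong : ∀ {x y} → x ≅ y [ q ] → ¬ + q ∣ᶻ x → ¬ + q ∣ᶻ y
  ∤-cong x≅y ¬x = ¬x ∘ ∣-cong x≅y

  inverse : ∀ {x} → ¬ + q ∣ᶻ x → ∃[ y ] ¬ + q ∣ᶻ y × x * y ≅ 1ℤ [ q ]
  inverse {x} ¬x =
    let y , e = bézout x ¬x
    in y , (λ d → ∤1 (∣-cong (≅-sym e) (∣n⇒∣m*n x d))) , e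
    where
    ring : ∀ m a → - m * - a ≡ m * a
    ring = solve-∀
    bézout : ∀ x → ¬ + q ∣ᶻ x → ∃[ y ] x * y ≅ 1ℤ [ q ]
    bézout (+ m) ¬d = bézoutℤ (∤⇒coprime (¬d ∘ ∣ᵤ⇒∣))
    bézout -[1+ m ] ¬d =
      let a , e = bézoutℤ {suc m} (∤⇒coprime (¬d ∘ ∣ᵤ⇒∣))
      in - a , ≅-trans (≅-reflexive (ring (+ suc m) a)) e

residue : ∀ n .{{_ : NonZero n}} → ℤ → Fin n
residue n x = fromℕ< (n%ℕd<d x n)

residue-≅ : ∀ n .{{_ : NonZero n}} x → + toℕ (residue n x) ≅ x [ n ]
residue-≅ n x = subst (λ r → + r ≅ x [ n ]) (sym (toℕ-fromℕ< (n%ℕd<d x n))) (%ℕ-≅ x n)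

residue-injective : ∀ n .{{_ : NonZero n}} {x y} → residue n x ≡ residue n y → x ≅ y [ n ]
residue-injective n {x} {y} eq = ≅-trans (≅-sym (residue-≅ n x))
  (subst (λ r → + toℕ r ≅ y [ n ]) (sym eq) (residue-≅ n y))

≅⇒≡ : ∀ {n i j} → i < n → j < n → + i ≅ + j [ n ] → i ≡ j
≅⇒≡ {n} {i} {j} i<n j<n (cong-mod d) with abs (+ i - + j) in eq | ∣⇒∣ᵤ d
... | zero  | _ = ℤ.+-injective (ℤ.i-j≡0⇒i≡j (+ i) (+ j) (ℤ.∣i∣≡0⇒i≡0 eq))
... | suc k | e = contradiction (ℕ.∣⇒≤ e) (ℕ.<⇒≱ (ℕ.≤-<-trans bound (ℕ.⊔-lub i<n j<n)))
  where
  bound : suc k ≤ i ℕ.⊔ j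
  bound = subst (ℕ._≤ i ℕ.⊔ j) (trans (cong abs (sym (ℤ.m-n≡m⊖n i j))) eq) (ℤ.∣m⊝n∣≤m⊔n i j)

toℕ-≅⇒≡ : ∀ {n} {i j : Fin n} → + toℕ i ≅ + toℕ j [ n ] → i ≡ j
toℕ-≅⇒≡ {i = i} {j} e = toℕ-injective (≅⇒≡ (toℕ<n i) (toℕ<n j) e)

-- Quadratic residues

module Residues (q : ℕ) where

  Square : ℤ → Set
  Square x = ∃[ y ] y * y ≅ x [ q ]

  -- The quadratic character as a relation with values in the group of signs, so that products of
  -- characters become products in `Sign`. Multiples of `q` satisfy `Square` but have no sign.
  HasSign : Sign → ℤ → Set
  HasSign Sign.+ x = ¬ + q ∣ᶻ x × Square x
  HasSign Sign.- x = ¬ + q ∣ᶻ x × ¬ Square x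

module Quadratic {q : ℕ} (pr : Prime q) (7≤q : 7 ≤ q) where

  private instance
    q≢0 : NonZero q
    q≢0 = prime⇒nonZero pr

  open Residues q public

  ∤small : ∀ k .{{_ : NonZero k}} → k < 7 → ¬ + q ∣ᶻ + k
  ∤small k k<7 d = ℕ.<⇒≱ (ℕ.≤-trans k<7 7≤q) (ℕ.∣⇒≤ (∣⇒∣ᵤ d))

  square? : ∀ x → Dec (Square x)
  square? x = map′ (λ (y , d) → + toℕ y , cong-mod d) from (any? λ y → + q ∣? + toℕ y * + toℕ y - x)
    where
    from : Square x → ∃[ y ] (+ q ∣ᶻ + toℕ y * + toℕ y - x)
    from (y , d) = residue q y , ∣-difference (≅-trans (≅-* (residue-≅ q y) (residue-≅ q y)) d)

  square-cong : ∀ {x y} → x ≅ y [ q ] → Square x → Square y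
  square-cong d (z , e) = z , ≅-trans e d

  HasSign⇒∤ : ∀ s {x} → HasSign s x → ¬ + q ∣ᶻ x
  HasSign⇒∤ Sign.+ = proj₁
  HasSign⇒∤ Sign.- = proj₁

  sign-of : ∀ {x} → ¬ + q ∣ᶻ x → ∃[ s ] HasSign s x
  sign-of {x} ¬d with square? x
  ... | yes p = Sign.+ , ¬d , p
  ... | no ¬p = Sign.- , ¬d , ¬p

  HasSign-cong : ∀ s {x y} → x ≅ y [ q ] → HasSign s x → HasSign s y
  HasSign-cong Sign.+ d (¬d , p) = ∤-cong pr d ¬d , square-cong d p
  HasSign-cong Sign.- d (¬d , ¬p) = ∤-cong pr d ¬d , ¬p ∘ square-cong (≅-sym d)

  square-* : ∀ {x y} → Square x → Square y → Square (x * y)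
  square-* {x} {y} (a , d) (b , e) = a * b , ≅-trans (≅-reflexive (ring a b)) (≅-* d e)
    where
    ring : ∀ a b → a * b * (a * b) ≡ a * a * (b * b)
    ring = solve-∀

  -- y = (x y) / x, and the quotient of z² by c² is (z / c)².
  square-/ : ∀ {x y} → ¬ + q ∣ᶻ x → Square x → Square (x * y) → Square y
  square-/ {x} {y} ¬x (c , d) (z , e) =
    let b , _ , f = inverse pr {c} (λ c∣ → ¬x (∣-cong (≅-sym d) (∣m⇒∣m*n c c∣)))
    in z * b , (begin
    z * b * (z * b)       ≡⟨ ring₁ z b ⟩
    z * z * (b * b)       ≈⟨ ≅-* e (≅-reflexive refl) ⟩
    x * y * (b * b)       ≈⟨ ≅-* (≅-* (≅-sym d) (≅-reflexive refl)) (≅-reflexive refl) ⟩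
    c * c * y * (b * b)   ≡⟨ ring₂ c y b ⟩
    c * b * (c * b) * y   ≈⟨ ≅-* (≅-* f f) (≅-reflexive refl) ⟩
    1ℤ * 1ℤ * y           ≡⟨ ℤ.*-identityˡ y ⟩
    y                     ∎)
    where
    open SetoidReasoning (≅-setoid q)
    ring₁ : ∀ z b → z * b * (z * b) ≡ z * z * (b * b)
    ring₁ = solve-∀
    ring₂ : ∀ c y b → c * c * y * (b * b) ≡ c * b * (c * b) * y
    ring₂ = solve-∀

-- The first bound keeps 1, ..., `h` distinct up to sign modulo `q`; the second lets three sets of
-- size `h` overflow the residues. With `h` the integer part of (q - 1)/2, the hypothesis 7 ≤ q
-- gives 3 ≤ h, so q ≤ 2h + 2 < 3h.
half : ∀ {q} → 7 ≤ q → ∃[ h ] h ℕ.+ h < q × q < 3 ℕ.* h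
half {suc m} (s≤s 6≤m) = h , s≤s h+h≤m , (begin-strict
  suc m                    ≡⟨ cong suc m≡ ⟩
  suc (m % 2 ℕ.+ (h ℕ.+ h)) ≤⟨ s≤s (ℕ.+-monoˡ-≤ _ (ℕ.s≤s⁻¹ (m%n<n m 2))) ⟩
  2 ℕ.+ (h ℕ.+ h)          <⟨ ℕ.+-monoˡ-≤ _ 3≤h ⟩
  h ℕ.+ (h ℕ.+ h)          ≡⟨ cong (λ z → h ℕ.+ (h ℕ.+ z)) (sym (ℕ.+-identityʳ h)) ⟩
  3 ℕ.* h                  ∎)
  where
  open ℕ.≤-Reasoning
  h : ℕ
  h = m / 2
  m≡ : m ≡ m % 2 ℕ.+ (h ℕ.+ h)
  m≡ = trans (m≡m%n+[m/n]*n m 2) (cong (m % 2 ℕ.+_) (trans (ℕ.*-comm h 2) (cong (h ℕ.+_) (ℕ.+-identityʳ h))))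
  h+h≤m : h ℕ.+ h ≤ m
  h+h≤m = subst (h ℕ.+ h ≤_) (sym m≡) (ℕ.m≤n+m _ (m % 2))
  3≤h : 3 ≤ h
  3≤h = /-monoˡ-≤ 2 6≤m

module _ {q : ℕ} (pr : Prime q) (7≤q : 7 ≤ q) where

  open Quadratic pr 7≤q

  private instance
    q≢0 : NonZero q
    q≢0 = prime⇒nonZero pr

  square-1 : Square 1ℤ
  square-1 = 1ℤ , ≅-reflexive refl

  ≅-squares : ∀ c a b → ¬ + q ∣ᶻ c → c * (a * a) ≅ c * (b * b) [ q ] → + q ∣ᶻ a - b ⊎ + q ∣ᶻ a + b
  ≅-squares c a b ¬c (cong-mod d) =
    [ (λ e → contradiction e ¬c) , prime-∣* pr (a - b) (a + b) ]′
      (prime-∣* pr c ((a - b) * (a + b)) (∣-resp (factor c a b) d))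
    where
    factor : ∀ c a b → c * (a * a) - c * (b * b) ≡ c * ((a - b) * (a + b))
    factor = solve-∀

  -- The cosets c · {i² : 1 ≤ i ≤ h} would be disjoint of size h, and 3 h > q.
  no-three-cosets : (c : Fin 3 → ℤ) → (∀ x → ¬ + q ∣ᶻ c x) →
                    ¬ (∀ x y → x ≢ y → ¬ Square (c x * c y))
  no-three-cosets c c-unit apart = ℕ.<⇒≱ (proj₂ (proj₂ (half 7≤q))) (injective⇒≤ F-injective)
    where
    h : ℕ
    h = proj₁ (half 7≤q)
    root : Fin h → ℤ
    root i = + suc (toℕ i)
    value : Fin 3 × Fin h → ℤ
    value (x , i) = c x * (root i * root i)
    F : Fin (3 ℕ.* h) → Fin q
    F k = residue q (value (Fin.remQuot h k))
    root+root<q : ∀ i j → suc (toℕ i) ℕ.+ suc (toℕ j) < q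
    root+root<q i j = ℕ.≤-<-trans (ℕ.+-mono-≤ (toℕ<n i) (toℕ<n j)) (proj₁ (proj₂ (half 7≤q)))
    root<q : ∀ (i : Fin h) → suc (toℕ i) < q
    root<q i = ℕ.≤-<-trans (ℕ.m≤m+n _ _) (root+root<q i i)
    root-unit : ∀ i → ¬ + q ∣ᶻ root i
    root-unit i d = ℕ.<⇒≱ (root<q i) (ℕ.∣⇒≤ (∣⇒∣ᵤ d))
    ≤root+root : ∀ {i j} → + q ∣ᶻ root i + root j → ¬ suc (toℕ i) ℕ.+ suc (toℕ j) < q
    ≤root+root {i} {j} d i+j<q = ℕ.<⇒≱ i+j<q (ℕ.∣⇒≤ (∣⇒∣ᵤ d))
    root-injective : ∀ x i j → value (x , i) ≅ value (x , j) [ q ] → i ≡ j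
    root-injective x i j d =
      [ (λ f → toℕ-injective (ℕ.suc-injective (≅⇒≡ {q} {suc (toℕ i)} {suc (toℕ j)} (root<q i) (root<q j) (cong-mod f))))
      , (λ f → contradiction (root+root<q i j) (≤root+root {i} {j} f))
      ]′ (≅-squares (c x) (root i) (root j) (c-unit x) d)
    cross₁ : ∀ b j → b * j * (b * j) ≡ b * (b * (j * j))
    cross₁ = solve-∀
    cross₂ : ∀ a b i → b * (a * (i * i)) ≡ i * i * (a * b)
    cross₂ = solve-∀
    -- A collision c x · i² ≅ c y · j² between different cosets makes i² · (c x · c y) the square of
    -- c y · j, hence c x · c y a square.
    value-injective : ∀ u v → value u ≅ value v [ q ] → u ≡ v
    value-injective (x , i) (y , j) d with x Fin.≟ y
    ... | yes refl = cong (x ,_) (root-injective x i j d)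
    ... | no x≢y = contradiction
      (square-/ {root i * root i} (∤-* pr (root-unit i) (root-unit i)) (root i , ≅-reflexive refl)
        (c y * root j , (begin
          c y * root j * (c y * root j)   ≡⟨ cross₁ (c y) (root j) ⟩
          c y * value (y , j)             ≈⟨ ≅-* (≅-reflexive {x = c y} refl) (≅-sym d) ⟩
          c y * value (x , i)             ≡⟨ cross₂ (c x) (c y) (root i) ⟩
          root i * root i * (c x * c y)   ∎)))
      (apart x y x≢y)
      where open SetoidReasoning (≅-setoid q)
    F-injective : ∀ {k l} → F k ≡ F l → k ≡ l
    F-injective {k} {l} eq = trans (sym (combine-remQuot {3} h k)) (trans
      (cong (λ u → Fin.combine (proj₁ u) (proj₂ u))
        (value-injective (Fin.remQuot h k) (Fin.remQuot h l)
          (residue-injective q {value (Fin.remQuot h k)} {value (Fin.remQuot h l)} eq)))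
      (combine-remQuot {3} h l))

  -- Otherwise 1, `x`, `y` would represent three different classes modulo squares. This replaces a
  -- primitive root or a count of the squares.
  nonsquare-* : ∀ {x y} → ¬ + q ∣ᶻ x → ¬ Square x → ¬ + q ∣ᶻ y → ¬ Square y → Square (x * y)
  nonsquare-* {x} {y} ¬x ¬sx ¬y ¬sy = decidable-stable (square? (x * y)) λ ¬sxy →
    no-three-cosets c c-unit (apart ¬sxy)
    where
    c : Fin 3 → ℤ
    c zero = 1ℤ
    c (suc zero) = x
    c (suc (suc zero)) = y
    c-unit : ∀ i → ¬ + q ∣ᶻ c i
    c-unit zero = ∤1 pr
    c-unit (suc zero) = ¬x
    c-unit (suc (suc zero)) = ¬y
    apart : ¬ Square (x * y) → ∀ i j → i ≢ j → ¬ Square (c i * c j)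
    apart ¬sxy zero zero i≢j = contradiction refl i≢j
    apart ¬sxy zero (suc zero) _ = ¬sx ∘ subst Square (ℤ.*-identityˡ x)
    apart ¬sxy zero (suc (suc zero)) _ = ¬sy ∘ subst Square (ℤ.*-identityˡ y)
    apart ¬sxy (suc zero) zero _ = ¬sx ∘ subst Square (ℤ.*-identityʳ x)
    apart ¬sxy (suc zero) (suc zero) i≢j = contradiction refl i≢j
    apart ¬sxy (suc zero) (suc (suc zero)) _ = ¬sxy
    apart ¬sxy (suc (suc zero)) zero _ = ¬sy ∘ subst Square (ℤ.*-identityʳ y)
    apart ¬sxy (suc (suc zero)) (suc zero) _ = ¬sxy ∘ subst Square (ℤ.*-comm y x)
    apart ¬sxy (suc (suc zero)) (suc (suc zero)) i≢j = contradiction refl i≢j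

  HasSign-* : ∀ s t {x y} → HasSign s x → HasSign t y → HasSign (s Sign.* t) (x * y)
  HasSign-* Sign.+ Sign.+ (¬x , sx) (¬y , sy) = ∤-* pr ¬x ¬y , square-* sx sy
  HasSign-* Sign.+ Sign.- {x} (¬x , sx) (¬y , sy) = ∤-* pr ¬x ¬y , sy ∘ square-/ {x} ¬x sx
  HasSign-* Sign.- Sign.+ {x} {y} (¬x , sx) (¬y , sy) = ∤-* pr ¬x ¬y ,
    sx ∘ square-/ {y} ¬y sy ∘ subst Square (ℤ.*-comm x y)
  HasSign-* Sign.- Sign.- (¬x , sx) (¬y , sy) = ∤-* pr ¬x ¬y , nonsquare-* ¬x sx ¬y sy

  -- If every residue had a square root then a choice of roots would be injective,
  -- hence could not miss one of the two roots ±1 of 1.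
  not-all-squares : ¬ (∀ (x : Fin q) → Square (+ toℕ x))
  not-all-squares all = ℕ.1+n≰n (injective⇒≤ F-injective)
    where
    r : Fin q → Fin q
    r x = residue q (proj₁ (all x))
    r² : ∀ x → + toℕ (r x) * + toℕ (r x) ≅ + toℕ x [ q ]
    r² x = ≅-trans (≅-* (residue-≅ q (proj₁ (all x))) (residue-≅ q (proj₁ (all x)))) (proj₂ (all x))
    r-injective : ∀ {x y} → r x ≡ r y → x ≡ y
    r-injective {x} {y} eq = toℕ-≅⇒≡ (≅-trans (≅-sym (r² x))
      (subst (λ z → + toℕ z * + toℕ z ≅ + toℕ y [ q ]) (sym eq) (r² y)))
    not-root : ∀ e → e * e ≡ 1ℤ → r (residue q 1ℤ) ≢ residue q e → ∀ x → r x ≢ residue q e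
    not-root e e² ≢e x ≡e = ≢e (trans (cong r (sym x≡1)) ≡e)
      where
      open SetoidReasoning (≅-setoid q)
      x≡1 : x ≡ residue q 1ℤ
      x≡1 = toℕ-≅⇒≡ (begin
        + toℕ x                                         ≈⟨ r² x ⟨
        + toℕ (r x) * + toℕ (r x)                       ≡⟨ cong (λ v → + toℕ v * + toℕ v) ≡e ⟩
        + toℕ (residue q e) * + toℕ (residue q e)       ≈⟨ ≅-* (residue-≅ q e) (residue-≅ q e) ⟩
        e * e                                           ≡⟨ e² ⟩
        1ℤ                                              ≈⟨ residue-≅ q 1ℤ ⟨
        + toℕ (residue q 1ℤ)                            ∎)
    missed : ∃[ v ] ∀ x → r x ≢ v
    missed with r (residue q 1ℤ) Fin.≟ residue q 1ℤ
    ... | no ≢1 = residue q 1ℤ , not-root 1ℤ refl ≢1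
    ... | yes ≡1 = residue q -1ℤ , not-root -1ℤ refl λ ≡-1 →
      ∤small 2 (s≤s (s≤s (s≤s z≤n))) (∣-difference (residue-injective q {1ℤ} { -1ℤ } (trans (sym ≡1) ≡-1)))
    F : Fin (suc q) → Fin q
    F zero = proj₁ missed
    F (suc x) = r x
    F-injective : ∀ {x y} → F x ≡ F y → x ≡ y
    F-injective {zero} {zero} _ = refl
    F-injective {zero} {suc y} eq = contradiction (sym eq) (proj₂ missed y)
    F-injective {suc x} {zero} eq = contradiction eq (proj₂ missed x)
    F-injective {suc x} {suc y} eq = cong suc (r-injective eq)

-- Linear equations whose unknowns have prescribed characters

module _ {q : ℕ} (pr : Prime q) (7≤q : 7 ≤ q) where

  open Quadratic pr 7≤q

  HasSign-square : ∀ {x} → ¬ + q ∣ᶻ x → HasSign Sign.+ (x * x)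
  HasSign-square {x} ¬x = ∤-* pr ¬x ¬x , x , ≅-reflexive refl

  HasSign-*-square : ∀ s {x y} → HasSign s x → ¬ + q ∣ᶻ y → HasSign s (x * (y * y))
  HasSign-*-square s {x} {y} hx ¬y = subst (λ t → HasSign t (x * (y * y))) (Sign.*-identityʳ s)
    (HasSign-* pr 7≤q s Sign.+ hx (HasSign-square ¬y))

  -- `y` ≅ `x` · `y`², so passing to the inverse only multiplies by a square.
  HasSign-inverse : ∀ s {x y} → ¬ + q ∣ᶻ y → x * y ≅ 1ℤ [ q ] → HasSign s x → HasSign s y
  HasSign-inverse s {x} {y} ¬y e hx = HasSign-cong s
    (≅-trans (≅-reflexive (sym (ℤ.*-assoc x y y)))
      (≅-trans (≅-* e (≅-reflexive refl)) (≅-reflexive (ℤ.*-identityˡ y))))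
    (HasSign-*-square s hx ¬y)

  square-0 : ∀ {x} → + q ∣ᶻ x → Square x
  square-0 d = 0ℤ , ≅-sym (∣⇒≅0 d)

  -- m + 1 is the least nonresidue.
  least-nonresidue : ∃[ m ] HasSign Sign.+ m × HasSign Sign.- (m + 1ℤ)
  least-nonresidue =
    let g , ¬sg , below = ¬∀⟶∃¬-smallest q (λ i → Square (+ toℕ i)) (λ i → square? (+ toℕ i)) (not-all-squares pr 7≤q)
    in predecessor (toℕ g) (toℕ<n g) ¬sg λ j j<g →
      subst (λ i → Square (+ i)) (trans (toℕ-inject {i = g} (fromℕ< j<g)) (toℕ-fromℕ< j<g)) (below (fromℕ< j<g))
    where
    predecessor : ∀ g → g < q → ¬ Square (+ g) → (∀ j → j < g → Square (+ j)) →
                  ∃[ m ] HasSign Sign.+ m × HasSign Sign.- (m + 1ℤ)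
    predecessor zero _ ¬sg _ = contradiction (square-0 (divides 0ℤ refl)) ¬sg
    predecessor (suc zero) _ ¬sg _ = contradiction (square-1 pr 7≤q) ¬sg
    predecessor (suc m@(suc _)) g<q ¬sg below = + m ,
      ((λ d → ℕ.<⇒≱ (ℕ.<-trans (ℕ.n<1+n m) g<q) (ℕ.∣⇒≤ (∣⇒∣ᵤ d))) , below m (ℕ.n<1+n m)) ,
      subst (λ x → HasSign Sign.- (+ x)) (ℕ.+-comm 1 m) (¬sg ∘ square-0 , ¬sg)

  -- 9 + 16 = 25 gives (+ , +), and (- , +) if -1 is a nonresidue. The other cases
  -- come from consecutive m, m + 1 of which only m is a residue.
  sum-to-1 : ∀ s t → ∃₂ λ x y → HasSign s x × HasSign t y × x + y ≅ 1ℤ [ q ]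
  sum-to-1 Sign.+ Sign.+ =
    let f , ¬f , 5f≅1 = inverse pr (∤small 5 (ℕ.m≤m+n 6 1))
    in + 3 * f * (+ 3 * f) , + 4 * f * (+ 4 * f) ,
       HasSign-square (∤-* pr (∤small 3 (ℕ.m≤m+n 4 3)) ¬f) ,
       HasSign-square (∤-* pr (∤small 4 (ℕ.m≤m+n 5 2)) ¬f) ,
       ≅-trans (≅-reflexive (ring f)) (≅-* 5f≅1 5f≅1)
    where
    ring : ∀ f → + 3 * f * (+ 3 * f) + + 4 * f * (+ 4 * f) ≡ + 5 * f * (+ 5 * f)
    ring = solve-∀
  sum-to-1 Sign.- Sign.- =
    let m , m+ , m+1- = least-nonresidue
        f , ¬f , e = inverse pr (proj₁ m+1-)
        f- = HasSign-inverse Sign.- ¬f e m+1-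
    in m * f , f , HasSign-* pr 7≤q Sign.+ Sign.- m+ f- , f- , ≅-trans (≅-reflexive (ring m f)) e
    where
    ring : ∀ m f → m * f + f ≡ (m + 1ℤ) * f
    ring = solve-∀
  sum-to-1 Sign.- Sign.+ = by-sign-of-minus-1 (sign-of {x = -1ℤ} (∤1 pr ∘ ∣m⇒∣-m))
    where
    ring₊ : ∀ m → m + 1ℤ + -1ℤ * m ≡ 1ℤ
    ring₊ = solve-∀
    ring₋ : ∀ f → -1ℤ * (+ 3 * f * (+ 3 * f)) + + 5 * f * (+ 5 * f) ≡ + 4 * f * (+ 4 * f)
    ring₋ = solve-∀
    by-sign-of-minus-1 : ∃[ s ] HasSign s -1ℤ →
      ∃₂ λ x y → HasSign Sign.- x × HasSign Sign.+ y × x + y ≅ 1ℤ [ q ]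
    by-sign-of-minus-1 (Sign.+ , h) =
      let m , m+ , m+1- = least-nonresidue
      in m + 1ℤ , -1ℤ * m , m+1- , HasSign-* pr 7≤q Sign.+ Sign.+ h m+ , ≅-reflexive (ring₊ m)
    by-sign-of-minus-1 (Sign.- , h) =
      let f , ¬f , 4f≅1 = inverse pr (∤small 4 (ℕ.m≤m+n 5 2))
      in -1ℤ * (+ 3 * f * (+ 3 * f)) , + 5 * f * (+ 5 * f) ,
         HasSign-* pr 7≤q Sign.- Sign.+ h (HasSign-square (∤-* pr (∤small 3 (ℕ.m≤m+n 4 3)) ¬f)) ,
         HasSign-square (∤-* pr (∤small 5 (ℕ.m≤m+n 6 1)) ¬f) ,
         ≅-trans (≅-reflexive (ring₋ f)) (≅-* 4f≅1 4f≅1)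
  sum-to-1 Sign.+ Sign.- =
    let x , y , hx , hy , e = sum-to-1 Sign.- Sign.+
    in y , x , hy , hx , ≅-trans (≅-reflexive (ℤ.+-comm y x)) e

  HasSign-*-cancel : ∀ s t {x y} → HasSign (s Sign.* t) x → HasSign t y → HasSign s (x * y)
  HasSign-*-cancel s t {x} {y} hx hy = subst (λ r → HasSign r (x * y))
    (trans (Sign.*-assoc s t t) (trans (cong (s Sign.*_) (Sign.s*s≡+ t)) (Sign.*-identityʳ s)))
    (HasSign-* pr 7≤q (s Sign.* t) t hx hy)

  -- Scale a solution of x + y ≅ 1: take a = x d/u and b = y d/v. The characters `σ` of d/u and `τ`
  -- of d/v are compensated in advance in those demanded of x and y.
  two-terms : ∀ s t {u v d} → ¬ + q ∣ᶻ u → ¬ + q ∣ᶻ v → ¬ + q ∣ᶻ d →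
              ∃₂ λ a b → HasSign s a × HasSign t b × a * u + b * v ≅ d [ q ]
  two-terms s t {u} {v} {d} ¬u ¬v ¬d =
    let u′ , ¬u′ , uu′ = inverse pr ¬u
        v′ , ¬v′ , vv′ = inverse pr ¬v
        σ , hu′d = sign-of (∤-* pr ¬u′ ¬d)
        τ , hv′d = sign-of (∤-* pr ¬v′ ¬d)
        x , y , hx , hy , x+y≅1 = sum-to-1 (s Sign.* σ) (t Sign.* τ)
    in x * (u′ * d) , y * (v′ * d) , HasSign-*-cancel s σ hx hu′d , HasSign-*-cancel t τ hy hv′d , (begin
      x * (u′ * d) * u + y * (v′ * d) * v     ≡⟨ ring x u′ d u y v′ v ⟩
      x * d * (u * u′) + y * d * (v * v′)     ≈⟨ ≅-+ (≅-* (≅-reflexive {x = x * d} refl) uu′) (≅-* (≅-reflexive {x = y * d} refl) vv′) ⟩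
      x * d * 1ℤ + y * d * 1ℤ                 ≡⟨ ring′ x y d ⟩
      (x + y) * d                             ≈⟨ ≅-* x+y≅1 (≅-reflexive refl) ⟩
      1ℤ * d                                  ≡⟨ ℤ.*-identityˡ d ⟩
      d                                       ∎)
    where
    open SetoidReasoning (≅-setoid q)
    ring : ∀ x u′ d u y v′ v → x * (u′ * d) * u + y * (v′ * d) * v ≡ x * d * (u * u′) + y * d * (v * v′)
    ring = solve-∀
    ring′ : ∀ x y d → x * d * 1ℤ + y * d * 1ℤ ≡ (x + y) * d
    ring′ = solve-∀

  has-sign : ∀ s → ∃[ x ] HasSign s x
  has-sign s = let x , _ , hx , _ = sum-to-1 s s in x , hx

  -- If d ≅ a w then d ≇ (4 a) w, since 3 is a unit.
  avoid : ∀ s {w d} → ¬ + q ∣ᶻ w → ∃[ a ] HasSign s a × ¬ + q ∣ᶻ d - a * w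
  avoid s {w} {d} ¬w = let a , ha = has-sign s in choose a ha (+ q ∣? d - a * w)
    where
    ring : ∀ a d w → d - a * w - (d - a * (+ 2 * + 2) * w) ≡ + 3 * (a * w)
    ring = solve-∀
    choose : ∀ a → HasSign s a → Dec (+ q ∣ᶻ d - a * w) → ∃[ a ] HasSign s a × ¬ + q ∣ᶻ d - a * w
    choose a ha (no ¬e) = a , ha , ¬e
    choose a ha (yes e) = a * (+ 2 * + 2) , HasSign-*-square s ha (∤small 2 (ℕ.m≤m+n 3 4)) , λ e′ →
      ∤-* pr (∤small 3 (ℕ.m≤m+n 4 3)) (∤-* pr (HasSign⇒∤ s ha) ¬w)
        (∣-resp (ring a d w) (∣m∣n⇒∣m-n e e′))

  -- The third weight is spent on keeping the remainder `d` - `c` `w` nonzero, as `two-terms`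
  -- requires. Hence `d` may be 0 here.
  three-terms : ∀ r s t {u v w d} → ¬ + q ∣ᶻ u → ¬ + q ∣ᶻ v → ¬ + q ∣ᶻ w →
                ∃ λ a → ∃₂ λ b c → HasSign r a × HasSign s b × HasSign t c × a * u + b * v + c * w ≅ d [ q ]
  three-terms r s t {u} {v} {w} {d} ¬u ¬v ¬w =
    let c , hc , ¬d = avoid t {d = d} ¬w
        a , b , ha , hb , e = two-terms r s ¬u ¬v ¬d
    in a , b , c , ha , hb , hc , ≅-trans (≅-+ e (≅-reflexive refl)) (≅-reflexive (ring d (c * w)))
    where
    ring : ∀ d x → d - x + x ≡ d
    ring = solve-∀

-- Zero-sums modulo one prime

infixl 7 _∙_
infixl 20 _[_]≔_

_∙_ : ∀ {l} → Vector ℤ l → Vector ℤ l → ℤ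
w ∙ u = sum (λ i → w i * u i)

_[_]≔_ : ∀ {l} {A : Set} → Vector A l → Fin l → A → Vector A l
w [ j ]≔ r = updateAt w j (const r)

[]≔-elim : ∀ {l} {A : Set} (P : Fin l → A → Set) {w : Vector A l} j {r} →
           (∀ i → i ≢ j → P i (w i)) → P j r → ∀ i → P i ((w [ j ]≔ r) i)
[]≔-elim P {w} j others new i with i Fin.≟ j
... | yes refl = subst (P j) (sym (updateAt-updates j w)) new
... | no i≢j = subst (P i) (sym (updateAt-minimal i j w i≢j)) (others i i≢j)

∙-[]≔ : ∀ {l} (w u : Vector ℤ l) j r → (w [ j ]≔ r) ∙ u ≡ w ∙ u + (r - w j) * u j
∙-[]≔ w u zero r = ring (w zero) r (u zero) ((w ∘ suc) ∙ (u ∘ suc))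
  where
  ring : ∀ w r u t → r * u + t ≡ w * u + t + (r - w) * u
  ring = solve-∀
∙-[]≔ w u (suc j) r = trans (cong (λ t → w zero * u zero + t) (∙-[]≔ (w ∘ suc) (u ∘ suc) j r))
  (sym (ℤ.+-assoc (w zero * u zero) _ _))

∙-∣ : ∀ {n l} (w u : Vector ℤ l) → (∀ i → + n ∣ᶻ w i * u i) → + n ∣ᶻ w ∙ u
∙-∣ {l = zero} w u d = divides 0ℤ refl
∙-∣ {l = suc l} w u d = ∣m∣n⇒∣m+n (d zero) (∙-∣ (w ∘ suc) (u ∘ suc) (d ∘ suc))

∙-congˡ : ∀ {n l} {w w′ : Vector ℤ l} (u : Vector ℤ l) → (∀ i → w i ≅ w′ i [ n ]) → w ∙ u ≅ w′ ∙ u [ n ]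
∙-congˡ {l = zero} u e = ≅-reflexive refl
∙-congˡ {l = suc l} u e = ≅-+ (≅-* (e zero) (≅-reflexive refl)) (∙-congˡ (u ∘ suc) (e ∘ suc))

-- The difference of the two sides is the sum with the weight at `i` reset to 0, and `n` divides
-- each of its terms.
∙-one : ∀ {n l} (w u : Vector ℤ l) i → (∀ k → k ≢ i → + n ∣ᶻ u k) → w ∙ u ≅ w i * u i [ n ]
∙-one {n} w u i off = ≅-by (trans (∙-[]≔ w u i 0ℤ) (ring (w ∙ u) (w i) (u i)))
  (∙-∣ (w [ i ]≔ 0ℤ) u ([]≔-elim (λ k x → + n ∣ᶻ x * u k) {w} i {0ℤ} (λ k k≢i → ∣n⇒∣m*n (w k) (off k k≢i)) (divides 0ℤ refl)))
  where
  ring : ∀ s w u → s + (0ℤ - w) * u ≡ s - w * u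
  ring = solve-∀

∙-two : ∀ {n l} (w u : Vector ℤ l) {i j} → i ≢ j → (∀ k → k ≢ i → k ≢ j → + n ∣ᶻ u k) →
        w ∙ u ≅ w i * u i + w j * u j [ n ]
∙-two {n} w u {i} {j} i≢j off = ≅-by
  (trans (∙-[]≔ (w [ i ]≔ 0ℤ) u j 0ℤ)
    (trans (cong₂ (λ s x → s + (0ℤ - x) * u j) (∙-[]≔ w u i 0ℤ) (updateAt-minimal j i w (i≢j ∘ sym)))
      (ring (w ∙ u) (w i) (u i) (w j) (u j))))
  (∙-∣ ((w [ i ]≔ 0ℤ) [ j ]≔ 0ℤ) u ([]≔-elim (λ k x → + n ∣ᶻ x * u k) {w [ i ]≔ 0ℤ} j {0ℤ}
    (λ k k≢j → []≔-elim (λ k x → k ≢ j → + n ∣ᶻ x * u k) {w} i {0ℤ}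
      (λ k k≢i k≢j → ∣n⇒∣m*n (w k) (off k k≢i k≢j)) (λ _ → divides 0ℤ refl) k k≢j)
    (divides 0ℤ refl)))
  where
  ring : ∀ s a b c d → s + (0ℤ - a) * b + (0ℤ - c) * d ≡ s - (a * b + c * d)
  ring = solve-∀

-- `none`, `one` and `two` are exact, while `three` means at least three: beyond two nonzero terms
-- the argument makes no further distinction.
data Count {l} (P : Fin l → Set) : Set where
  none  : (∀ i → ¬ P i) → Count P
  one   : ∀ i → P i → (∀ k → k ≢ i → ¬ P k) → Count P
  two   : ∀ i j → i ≢ j → P i → P j → (∀ k → k ≢ i → k ≢ j → ¬ P k) → Count P
  three : ∀ i j k → i ≢ j → i ≢ k → j ≢ k → P i → P j → P k → Count P

count : ∀ {l} {P : Fin l → Set} → (∀ i → Dec (P i)) → Count P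
count P? with any? P?
... | no ∄ = none λ i p → ∄ (i , p)
... | yes (i , pᵢ) with any? (λ j → ¬? (j Fin.≟ i) ×-dec P? j)
... | no ∄ = one i pᵢ λ k k≢i p → ∄ (k , k≢i , p)
... | yes (j , j≢i , pⱼ) with any? (λ k → ¬? (k Fin.≟ i) ×-dec ¬? (k Fin.≟ j) ×-dec P? k)
... | no ∄ = two i j (j≢i ∘ sym) pᵢ pⱼ λ k k≢i k≢j p → ∄ (k , k≢i , k≢j , p)
... | yes (k , k≢i , k≢j , pₖ) = three i j k (j≢i ∘ sym) (k≢i ∘ sym) (k≢j ∘ sym) pᵢ pⱼ pₖ

-- The local criterion for a zero-sum with unit weights modulo `q`, in positive form: every nonzero
-- entry comes with a second one as witness.
NotOne : ℕ → ∀ {l} → Vector ℤ l → Set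
NotOne q u = ∀ i → ¬ + q ∣ᶻ u i → ∃[ j ] j ≢ i × ¬ + q ∣ᶻ u j

module _ {q : ℕ} (pr : Prime q) (7≤q : 7 ≤ q) {l : ℕ} (u : Vector ℤ l) where

  open Residues q

  all-signs-none : (∀ i → + q ∣ᶻ u i) → ∀ (s : Fin l → Sign) →
                   ∃[ w ] (∀ i → HasSign (s i) (w i)) × + q ∣ᶻ w ∙ u
  all-signs-none off s = w , (λ i → proj₂ (has-sign pr 7≤q (s i))) ,
    ∙-∣ w u (λ i → ∣n⇒∣m*n (w i) (off i))
    where
    w : Vector ℤ l
    w i = proj₁ (has-sign pr 7≤q (s i))

  -- Start from any weights with the prescribed characters and choose those at `i`, `j`, `k` anew.
  -- The value `d` handed to `three-terms` is minus the contribution of all the other positions.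
  all-signs-three : ∀ {i j k} → i ≢ j → i ≢ k → j ≢ k →
                    ¬ + q ∣ᶻ u i → ¬ + q ∣ᶻ u j → ¬ + q ∣ᶻ u k → ∀ (s : Fin l → Sign) →
                    ∃[ w ] (∀ i → HasSign (s i) (w i)) × + q ∣ᶻ w ∙ u
  all-signs-three {i} {j} {k} i≢j i≢k j≢k uᵢ uⱼ uₖ s =
    let a , b , c , ha , hb , hc , e = three-terms pr 7≤q (s i) (s j) (s k)
          {d = w i * u i + w j * u j + w k * u k - w ∙ u} uᵢ uⱼ uₖ
    in ((w [ i ]≔ a) [ j ]≔ b) [ k ]≔ c ,
       []≔-elim P k (λ k _ → []≔-elim P j (λ j _ → []≔-elim P {w} i (λ i _ → signs i) ha j) hb k) hc ,
       ≅0⇒∣ (begin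
         (((w [ i ]≔ a) [ j ]≔ b) [ k ]≔ c) ∙ u
           ≡⟨ trans (∙-[]≔ ((w [ i ]≔ a) [ j ]≔ b) u k c) (cong₂ (λ t x → t + (c - x) * u k)
                (trans (∙-[]≔ (w [ i ]≔ a) u j b) (cong₂ (λ t x → t + (b - x) * u j)
                  (∙-[]≔ w u i a)
                  (updateAt-minimal j i w (i≢j ∘ sym))))
                (trans (updateAt-minimal k j (w [ i ]≔ a) (j≢k ∘ sym)) (updateAt-minimal k i w (i≢k ∘ sym)))) ⟩
         w ∙ u + (a - w i) * u i + (b - w j) * u j + (c - w k) * u k
           ≡⟨ ring (w ∙ u) a (w i) (u i) b (w j) (u j) c (w k) (u k) ⟩
         (a * u i + b * u j + c * u k) - (w i * u i + w j * u j + w k * u k - w ∙ u)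
           ≈⟨ ∣⇒≅0 (∣-difference e) ⟩
         0ℤ ∎)
    where
    open SetoidReasoning (≅-setoid q)
    P : Fin l → ℤ → Set
    P i = HasSign (s i)
    w : Vector ℤ l
    w i = proj₁ (has-sign pr 7≤q (s i))
    signs : ∀ i → P i (w i)
    signs i = proj₂ (has-sign pr 7≤q (s i))
    ring : ∀ t a w u b x v c y z → t + (a - w) * u + (b - x) * v + (c - y) * z
           ≡ (a * u + b * v + c * z) - (w * u + x * v + y * z - t)
    ring = solve-∀

  -- Only two terms survive modulo `q`, so the weight at `j` is forced to be -(w i · u i)/u j. Its
  -- character cannot be prescribed; it is merely recorded, as `σ`.
  all-signs-but-one : ∀ {i j} → i ≢ j → ¬ + q ∣ᶻ u i → ¬ + q ∣ᶻ u j →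
                      (∀ k → k ≢ i → k ≢ j → + q ∣ᶻ u k) → ∀ (s : Fin l → Sign) →
                      ∃₂ λ t w → (∀ k → k ≢ j → t k ≡ s k) × (∀ k → HasSign (t k) (w k)) × + q ∣ᶻ w ∙ u
  all-signs-but-one {i} {j} i≢j uᵢ uⱼ off s =
    let v , ¬v , e = inverse pr uⱼ
        r = - (w i * u i) * v
        σ , hr = sign-of (∤-* pr (∤-* pr (HasSign⇒∤ (s i) (signs i)) uᵢ ∘ ∣-neg (w i * u i)) ¬v)
    in s [ j ]≔ σ , w [ j ]≔ r ,
       (λ k k≢j → updateAt-minimal k j s k≢j) ,
       []≔-elim (λ k x → HasSign ((s [ j ]≔ σ) k) x) j
         (λ k k≢j → subst (λ τ → HasSign τ (w k)) (sym (updateAt-minimal k j s k≢j)) (signs k))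
         (subst (λ τ → HasSign τ r) (sym (updateAt-updates j s)) hr) ,
       ≅0⇒∣ (begin
         (w [ j ]≔ r) ∙ u
           ≈⟨ ∙-two (w [ j ]≔ r) u i≢j off ⟩
         (w [ j ]≔ r) i * u i + (w [ j ]≔ r) j * u j
           ≡⟨ cong₂ (λ x y → x * u i + y * u j) (updateAt-minimal i j w i≢j) (updateAt-updates j w) ⟩
         w i * u i + - (w i * u i) * v * u j
           ≡⟨ ring (w i * u i) v (u j) ⟩
         w i * u i - w i * u i * (u j * v)
           ≈⟨ ≅-+ (≅-reflexive {x = w i * u i} refl) (≅-neg (≅-* (≅-reflexive {x = w i * u i} refl) e)) ⟩
         w i * u i - w i * u i * 1ℤ
           ≡⟨ ring′ (w i * u i) ⟩
         0ℤ ∎)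
    where
    open SetoidReasoning (≅-setoid q)
    open Quadratic pr 7≤q using (sign-of; HasSign⇒∤)
    w : Vector ℤ l
    w i = proj₁ (has-sign pr 7≤q (s i))
    signs : ∀ i → HasSign (s i) (w i)
    signs i = proj₂ (has-sign pr 7≤q (s i))
    ∣-neg : ∀ x → + q ∣ᶻ - x → + q ∣ᶻ x
    ∣-neg x d = ∣-resp (ℤ.neg-involutive x) (∣m⇒∣-m d)
    ring : ∀ a v u → a + - a * v * u ≡ a - a * (u * v)
    ring = solve-∀
    ring′ : ∀ a → a - a * 1ℤ ≡ 0ℤ
    ring′ = solve-∀

  support-count : Count (λ i → ¬ + q ∣ᶻ u i)
  support-count = count (λ i → ¬? (+ q ∣? u i))

  ∣-stable : ∀ {i} → ¬ ¬ + q ∣ᶻ u i → + q ∣ᶻ u i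
  ∣-stable {i} = decidable-stable (+ q ∣? u i)

  -- If `u i` were the only nonzero entry, the sum would be congruent to `w i * u i`, which is not
  -- divisible by `q`. Weights need to be units on the support only, because in a masked sequence
  -- the deselected positions carry filler weights.
  zero-sum⇒NotOne : ∀ w → (∀ i → ¬ + q ∣ᶻ u i → ¬ + q ∣ᶻ w i) → + q ∣ᶻ w ∙ u → NotOne q u
  zero-sum⇒NotOne w w-unit d i uᵢ with any? (λ j → ¬? (j Fin.≟ i) ×-dec ¬? (+ q ∣? u j))
  ... | yes found = found
  ... | no ∄ = contradiction (∣-cong (≅-sym (∙-one w u i λ k k≢i → ∣-stable λ uₖ → ∄ (k , k≢i , uₖ))) d)
                 (∤-* pr (w-unit i uᵢ) uᵢ)

  NotOne⇒zero-sum : NotOne q u → ∃₂ λ s w → (∀ i → HasSign (s i) (w i)) × + q ∣ᶻ w ∙ u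
  NotOne⇒zero-sum not-one with support-count
  ... | none off = const Sign.+ , all-signs-none (λ i → ∣-stable (off i)) (const Sign.+)
  ... | one i uᵢ off = let j , j≢i , uⱼ = not-one i uᵢ in contradiction uⱼ (off j j≢i)
  ... | two i j i≢j uᵢ uⱼ off =
    let t , w , _ , rest = all-signs-but-one i≢j uᵢ uⱼ (λ k k≢i k≢j → ∣-stable (off k k≢i k≢j)) (const Sign.+)
    in t , w , rest
  ... | three i j k i≢j i≢k j≢k uᵢ uⱼ uₖ =
    const Sign.+ , all-signs-three i≢j i≢k j≢k uᵢ uⱼ uₖ (const Sign.+)

-- Combining the primes

-- The hypothesis may answer differently for different proofs of membership. Using the proof found
-- by `_∈?_` gives a function of the number alone, with `a₀` as its value off the list.
choice : ∀ {A : Set} (xs : List ℕ) → A → (B : ℕ → A → Set) →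
         (∀ {x} → x ∈ xs → ∃ (B x)) → ∃[ f ] (∀ {x} → x ∈ xs → B x (f x))
choice {A} xs a₀ B h = (λ x → pick (x ∈? xs)) , λ {x} x∈xs → pick-correct x∈xs (x ∈? xs)
  where
  pick : ∀ {x} → Dec (x ∈ xs) → A
  pick (yes x∈xs) = proj₁ (h x∈xs)
  pick (no _) = a₀
  pick-correct : ∀ {x} → x ∈ xs → (d : Dec (x ∈ xs)) → B x (pick d)
  pick-correct _ (yes x∈xs) = proj₂ (h x∈xs)
  pick-correct x∈xs (no x∉xs) = contradiction x∈xs x∉xs

module _ {A : Set} where

  _⟦_↦_⟧ : (ℕ → A) → ℕ → A → ℕ → A
  (f ⟦ p ↦ a ⟧) q = if does (q ℕ.≟ p) then a else f q

  ↦-at : ∀ (f : ℕ → A) p a → (f ⟦ p ↦ a ⟧) p ≡ a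
  ↦-at f p a = cong (λ b → if b then a else f p) (dec-true (p ℕ.≟ p) refl)

  ↦-off : ∀ (f : ℕ → A) p a {q} → q ≢ p → (f ⟦ p ↦ a ⟧) q ≡ f q
  ↦-off f p a {q} q≢p = cong (λ b → if b then a else f q) (dec-false (q ℕ.≟ p) q≢p)

  ↦-elim : ∀ (P : ℕ → A → Set) (f : ℕ → A) p a {q} →
           P q (f q) → P p a → P q ((f ⟦ p ↦ a ⟧) q)
  ↦-elim P f p a {q} old new with q ℕ.≟ p
  ... | yes refl = subst (P q) (sym (↦-at f p a)) new
  ... | no q≢p = subst (P q) (sym (↦-off f p a q≢p)) old

∏ : (ℕ → Sign) → List ℕ → Sign
∏ σ = foldr (λ q → σ q Sign.*_) Sign.+

∏-cong : ∀ {σ τ} ps → (∀ {q} → q ∈ ps → σ q ≡ τ q) → ∏ σ ps ≡ ∏ τ ps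
∏-cong [] e = refl
∏-cong (p ∷ ps) e = cong₂ Sign._*_ (e (here refl)) (∏-cong ps (e ∘ there))

-- As `p` occurs only once in `ps`, the two products differ in a single factor; the relation is
-- cross-multiplied to avoid quotients.
∏-change : ∀ {σ τ p ps} → Unique ps → p ∈ ps → (∀ {q} → q ≢ p → τ q ≡ σ q) →
           ∏ τ ps Sign.* σ p ≡ ∏ σ ps Sign.* τ p
∏-change {σ} {τ} {p} {_ ∷ ps} (p∉ps ∷ _) (here refl) e = trans
  (xy∙z≈zy∙x (τ p) (∏ τ ps) (σ p))
  (cong (λ t → σ p Sign.* t Sign.* τ p) (∏-cong ps λ q∈ps → e λ q≡p → All.lookup p∉ps q∈ps (sym q≡p)))
∏-change {σ} {τ} {p} {p₁ ∷ ps} (p∉ps ∷ uniq) (there p∈ps) e = begin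
  τ p₁ Sign.* ∏ τ ps Sign.* σ p     ≡⟨ Sign.*-assoc (τ p₁) _ _ ⟩
  τ p₁ Sign.* (∏ τ ps Sign.* σ p)   ≡⟨ cong₂ Sign._*_ (e (All.lookup p∉ps p∈ps)) (∏-change {σ} {τ} uniq p∈ps e) ⟩
  σ p₁ Sign.* (∏ σ ps Sign.* τ p)   ≡⟨ Sign.*-assoc (σ p₁) _ _ ⟨
  σ p₁ Sign.* ∏ σ ps Sign.* τ p     ∎
  where open ≡-Reasoning

-- Signs are their own inverses, so `∏ σ ps` times `σ p` is the product over the primes other than
-- `p`. One more factor `σ r`, put into the new sign at `p`, makes the total equal `σ r`, which the
-- change at `p` leaves alone.
∏-balance : ∀ {σ τ p r ps} → Unique ps → p ∈ ps → r ≢ p → (∀ {q} → q ≢ p → τ q ≡ σ q) →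
            τ p ≡ ∏ σ ps Sign.* σ p Sign.* σ r → ∏ τ ps ≡ τ r
∏-balance {σ} {τ} {p} {r} {ps} uniq p∈ps r≢p e eq = trans
  (Sign.*-cancelʳ-≡ (σ p) (∏ τ ps) (σ r) (begin
    ∏ τ ps Sign.* σ p                                  ≡⟨ ∏-change {σ} {τ} uniq p∈ps e ⟩
    ∏ σ ps Sign.* τ p                                  ≡⟨ cong (∏ σ ps Sign.*_) eq ⟩
    ∏ σ ps Sign.* (∏ σ ps Sign.* σ p Sign.* σ r)       ≡⟨ cancel (∏ σ ps) (σ p) (σ r) ⟩
    σ r Sign.* σ p                                     ∎))
  (sym (e r≢p))
  where
  open ≡-Reasoning
  cancel : ∀ a b c → a Sign.* (a Sign.* b Sign.* c) ≡ c Sign.* b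
  cancel a b c = begin
    a Sign.* (a Sign.* b Sign.* c)     ≡⟨ cong (a Sign.*_) (Sign.*-assoc a b c) ⟩
    a Sign.* (a Sign.* (b Sign.* c))   ≡⟨ Sign.*-assoc a a _ ⟨
    a Sign.* a Sign.* (b Sign.* c)     ≡⟨ cong (Sign._* (b Sign.* c)) (Sign.s*s≡+ a) ⟩
    b Sign.* c                         ≡⟨ Sign.*-comm b c ⟩
    c Sign.* b                         ∎

Signed : ℕ → Set
Signed l = (Fin l → Sign) × Vector ℤ l

Solves : ℕ → ∀ {l} → Vector ℤ l → Signed l → Set
Solves q u (s , w) = (∀ i → Residues.HasSign q (s i) (w i)) × + q ∣ᶻ w ∙ u

module Global (ps : List ℕ) (prime : ∀ {q} → q ∈ ps → Prime q) (7≤ : ∀ {q} → q ∈ ps → 7 ≤ q)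
              (unique : Unique ps) (p′ : ℕ) where

  -- The i-th weight lies in L(n;p′).
  Balanced : ∀ {l} → (ℕ → Signed l) → Fin l → Set
  Balanced f i = ∏ (λ q → proj₁ (f q) i) ps ≡ proj₁ (f p′) i

  Solvable : ∀ {l} → Vector ℤ l → Set
  Solvable {l} u = ∃[ f ] (∀ {q} → q ∈ ps → Solves q u (f q)) × ∀ i → Balanced f i

  module _ {l} {u : Vector ℤ l} where

    target : (ℕ → Signed l) → ℕ → Fin l → Sign
    target f q₀ i = ∏ (λ q → proj₁ (f q) i) ps Sign.* proj₁ (f q₀) i Sign.* proj₁ (f p′) i

    balanced-at : ∀ f {q₀} g i → q₀ ∈ ps → q₀ ≢ p′ → proj₁ g i ≡ target f q₀ i → Balanced (f ⟦ q₀ ↦ g ⟧) i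
    balanced-at f {q₀} g i q₀∈ps q₀≢p′ eq = ∏-balance
      {λ q → proj₁ (f q) i} {λ q → proj₁ ((f ⟦ q₀ ↦ g ⟧) q) i} unique q₀∈ps (q₀≢p′ ∘ sym)
      (λ q≢q₀ → cong (λ h → proj₁ h i) (↦-off f q₀ g q≢q₀))
      (trans (cong (λ h → proj₁ h i) (↦-at f q₀ g)) eq)

    locally-solvable : (∀ {q} → q ∈ ps → NotOne q u) → ∃[ f ] (∀ {q} → q ∈ ps → Solves q u (f q))
    locally-solvable not-one = choice ps (const Sign.+ , const 0ℤ) (λ q → Solves q u) λ q∈ps →
      let s , w , sol = NotOne⇒zero-sum (prime q∈ps) (7≤ q∈ps) u (not-one q∈ps) in (s , w) , sol

    -- Keep arbitrary local solutions at the other primes and solve again at `q₀` with the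
    -- characters that `∏-balance` asks for. At `p′` itself a change would alter both sides of
    -- `Balanced` together and repair nothing.
    solvable-free : (∀ {q} → q ∈ ps → NotOne q u) → ∀ {q₀} → q₀ ∈ ps → q₀ ≢ p′ →
                    (∀ s → ∃[ w ] Solves q₀ u (s , w)) → Solvable u
    solvable-free not-one {q₀} q₀∈ps q₀≢p′ free =
      let f , sol = locally-solvable not-one
          w , sol₀ = free (target f q₀)
      in f ⟦ q₀ ↦ target f q₀ , w ⟧ ,
         (λ q∈ps → ↦-elim (λ q → Solves q u) f q₀ _ (sol q∈ps) sol₀) ,
         λ i → balanced-at f (target f q₀ , w) i q₀∈ps q₀≢p′ refl

    solvable-none : (∀ {q} → q ∈ ps → NotOne q u) → ∀ {q₀} → q₀ ∈ ps → q₀ ≢ p′ →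
                    (∀ i → + q₀ ∣ᶻ u i) → Solvable u
    solvable-none not-one q₀∈ps q₀≢p′ off =
      solvable-free not-one q₀∈ps q₀≢p′ (all-signs-none (prime q₀∈ps) (7≤ q₀∈ps) u off)

    solvable-three : (∀ {q} → q ∈ ps → NotOne q u) → ∀ {q₀} → q₀ ∈ ps → q₀ ≢ p′ →
                     ∀ {i j k} → i ≢ j → i ≢ k → j ≢ k →
                     ¬ + q₀ ∣ᶻ u i → ¬ + q₀ ∣ᶻ u j → ¬ + q₀ ∣ᶻ u k → Solvable u
    solvable-three not-one q₀∈ps q₀≢p′ i≢j i≢k j≢k uᵢ uⱼ uₖ =
      solvable-free not-one q₀∈ps q₀≢p′ (all-signs-three (prime q₀∈ps) (7≤ q₀∈ps) u i≢j i≢k j≢k uᵢ uⱼ uₖ)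

    -- Correct the signs off j modulo q₁; coordinate j is free modulo q₂.
    solvable-two : (∀ {q} → q ∈ ps → NotOne q u) → ∀ {q₁ q₂} → q₁ ∈ ps → q₁ ≢ p′ → q₂ ∈ ps → q₂ ≢ p′ →
                   ∀ {i j} → i ≢ j → ¬ + q₁ ∣ᶻ u i → ¬ + q₁ ∣ᶻ u j → (∀ k → k ≢ i → k ≢ j → + q₁ ∣ᶻ u k) →
                   + q₂ ∣ᶻ u j → Solvable u
    solvable-two not-one {q₁} {q₂} q₁∈ps q₁≢p′ q₂∈ps q₂≢p′ {i} {j} i≢j uᵢ uⱼ off q₂∣uⱼ =
      let f , sol = locally-solvable not-one
          t , w , t≡ , sol₁ = all-signs-but-one (prime q₁∈ps) (7≤ q₁∈ps) u i≢j uᵢ uⱼ off (target f q₁)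
      in correct (f ⟦ q₁ ↦ t , w ⟧)
           (λ q∈ps → ↦-elim (λ q → Solves q u) f q₁ (t , w) (sol q∈ps) sol₁)
           (λ k k≢j → balanced-at f (t , w) k q₁∈ps q₁≢p′ (t≡ k k≢j))
      where
      correct : ∀ f → (∀ {q} → q ∈ ps → Solves q u (f q)) → (∀ k → k ≢ j → Balanced f k) → Solvable u
      correct f sol bal =
        f ⟦ q₂ ↦ g ⟧ , (λ q∈ps → ↦-elim (λ q → Solves q u) f q₂ g (sol q∈ps) sol₂) , balanced
        where
        τ : Sign
        τ = target f q₂ j
        r : ∃[ r ] Residues.HasSign q₂ τ r
        r = has-sign (prime q₂∈ps) (7≤ q₂∈ps) τ
        g : Signed l
        g = proj₁ (f q₂) [ j ]≔ τ , proj₂ (f q₂) [ j ]≔ proj₁ r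
        sol₂ : Solves q₂ u g
        sol₂ =
          []≔-elim (λ k x → Residues.HasSign q₂ (proj₁ g k) x) j
            (λ k k≢j → subst (λ σ → Residues.HasSign q₂ σ (proj₂ (f q₂) k))
              (sym (updateAt-minimal k j (proj₁ (f q₂)) k≢j)) (proj₁ (sol q₂∈ps) k))
            (subst (λ σ → Residues.HasSign q₂ σ (proj₁ r)) (sym (updateAt-updates j (proj₁ (f q₂)))) (proj₂ r)) ,
          ∣-resp (sym (∙-[]≔ (proj₂ (f q₂)) u j (proj₁ r)))
            (∣m∣n⇒∣m+n (proj₂ (sol q₂∈ps)) (∣n⇒∣m*n (proj₁ r - proj₂ (f q₂) j) q₂∣uⱼ))
        same : ∀ k → k ≢ j → ∀ q → proj₁ ((f ⟦ q₂ ↦ g ⟧) q) k ≡ proj₁ (f q) k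
        same k k≢j q = ↦-elim (λ q h → proj₁ h k ≡ proj₁ (f q) k) f q₂ g {q} refl
          (updateAt-minimal k j (proj₁ (f q₂)) k≢j)
        balanced : ∀ k → Balanced (f ⟦ q₂ ↦ g ⟧) k
        balanced k with k Fin.≟ j
        ... | yes refl = balanced-at f g k q₂∈ps q₂≢p′ (updateAt-updates k (proj₁ (f q₂)))
        ... | no k≢j = trans (∏-cong ps (λ {q} _ → same k k≢j q)) (trans (bal k k≢j) (sym (same k k≢j p′)))

-- Choosing the subsequence

-- Deselected terms become 0, so a subsequence keeps the length of the sequence.
mask : ∀ {l} → (Fin l → Bool) → Vector ℤ l → Vector ℤ l
mask S v i = if S i then v i else 0ℤ

module _ {n : ℕ} {l : ℕ} (S : Fin l → Bool) (v : Vector ℤ l) {i : Fin l} where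

  ∣-mask : (Bool.T (S i) → + n ∣ᶻ v i) → + n ∣ᶻ mask S v i
  ∣-mask d = go (S i) d
    where
    go : ∀ b → (Bool.T b → + n ∣ᶻ v i) → + n ∣ᶻ (if b then v i else 0ℤ)
    go true d = d tt
    go false _ = divides 0ℤ refl

  ∤-mask : Bool.T (S i) → ¬ + n ∣ᶻ v i → ¬ + n ∣ᶻ mask S v i
  ∤-mask = go (S i)
    where
    go : ∀ b → Bool.T b → ¬ + n ∣ᶻ v i → ¬ + n ∣ᶻ (if b then v i else 0ℤ)
    go true _ ¬d = ¬d

  ∤-unmask : ¬ + n ∣ᶻ mask S v i → Bool.T (S i) × ¬ + n ∣ᶻ v i
  ∤-unmask = go (S i)
    where
    go : ∀ b → ¬ + n ∣ᶻ (if b then v i else 0ℤ) → Bool.T b × ¬ + n ∣ᶻ v i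
    go true ¬d = tt , ¬d
    go false ¬d = contradiction (divides 0ℤ refl) ¬d

-- Pigeonhole: otherwise sending each index to one of `a`, `b`, `c` that it equals would be an
-- injection into three elements. Repetitions among `a`, `b`, `c` are allowed and do occur.
fresh : ∀ {l} → 3 < l → (a b c : Fin l) → ∃[ z ] z ≢ a × z ≢ b × z ≢ c
fresh {l} 3<l a b c with any? (λ z → ¬? (z Fin.≟ a) ×-dec ¬? (z Fin.≟ b) ×-dec ¬? (z Fin.≟ c))
... | yes found = found
... | no ∄ = contradiction (injective⇒≤ index-injective) (ℕ.<⇒≱ 3<l)
  where
  abc : Fin 3 → Fin l
  abc zero = a
  abc (suc zero) = b
  abc (suc (suc zero)) = c
  covered : ∀ z → ∃[ k ] z ≡ abc k
  covered z with z Fin.≟ a | z Fin.≟ b | z Fin.≟ c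
  ... | yes e | _ | _ = zero , e
  ... | no _ | yes e | _ = suc zero , e
  ... | no _ | no _ | yes e = suc (suc zero) , e
  ... | no za | no zb | no zc = contradiction (z , za , zb , zc) ∄
  index-injective : ∀ {y z} → proj₁ (covered y) ≡ proj₁ (covered z) → y ≡ z
  index-injective {y} {z} e = trans (proj₂ (covered y)) (trans (cong abc e) (sym (proj₂ (covered z))))

search : ∀ {P : ℕ → Set} → (∀ q → Dec (P q)) → (ps : List ℕ) →
         (∃[ q ] q ∈ ps × P q) ⊎ (∀ {q} → q ∈ ps → ¬ P q)
search P? ps with Any.any? P? ps
... | yes a = inj₁ (find a)
... | no ¬a = inj₂ λ q∈ps p → ¬a (lose q∈ps p)

module _ {q l : ℕ} {u : Vector ℤ l} where

  NotOne-none : (∀ i → + q ∣ᶻ u i) → NotOne q u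
  NotOne-none off i uᵢ = contradiction (off i) uᵢ

  NotOne-two : ∀ {i j} → i ≢ j → ¬ + q ∣ᶻ u i → ¬ + q ∣ᶻ u j → NotOne q u
  NotOne-two {i} {j} i≢j uᵢ uⱼ k _ with k Fin.≟ i
  ... | yes refl = j , i≢j ∘ sym , uⱼ
  ... | no k≢i = i , k≢i ∘ sym , uᵢ

-- Replacing a subsequence by one with balanced weights

module Combinatorial (ps : List ℕ) (prime : ∀ {q} → q ∈ ps → Prime q) (7≤ : ∀ {q} → q ∈ ps → 7 ≤ q)
              (unique : Unique ps) {p′ : ℕ} (p′∈ps : p′ ∈ ps) {q₁} (q₁∈ps : q₁ ∈ ps) (q₁≢p′ : q₁ ≢ p′)
              {l : ℕ} (3<l : 3 < l) (v : Vector ℤ l) where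

  open Global ps prime 7≤ unique p′

  HasSolvable : Set
  HasSolvable = ∃[ S ] (∃[ i ] Bool.T (S i)) × Solvable (mask S v)

  off-p′ : ∀ {P : ℕ → Set} → (∀ {q} → q ∈ ps → q ≢ p′ → P q) → P p′ → ∀ {q} → q ∈ ps → P q
  off-p′ {P} other at {q} q∈ps with q ℕ.≟ p′
  ... | yes refl = at
  ... | no q≢p′ = other q∈ps q≢p′

  Only-p′ : Fin l → Set
  Only-p′ z = ∀ q → q ∈ ps → q ≢ p′ → + q ∣ᶻ v z

  only-p′? : ∀ z → (∃[ q ] q ∈ ps × q ≢ p′ × ¬ + q ∣ᶻ v z) ⊎ Only-p′ z
  only-p′? z with search (λ q → ¬? (q ℕ.≟ p′) ×-dec ¬? (+ q ∣? v z)) ps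
  ... | inj₁ found = inj₁ found
  ... | inj₂ ∄ = inj₂ λ q q∈ps q≢p′ → decidable-stable (+ q ∣? v z) λ ¬d → ∄ q∈ps (q≢p′ , ¬d)

  singleton : ∀ {z} → Only-p′ z → + p′ ∣ᶻ v z → HasSolvable
  singleton {z} lonely p′∣ = S , (z , fromWitness {a? = z Fin.≟ z} refl) ,
    solvable-none (λ q∈ps → NotOne-none (vanishes q∈ps)) q₁∈ps q₁≢p′ (vanishes q₁∈ps)
    where
    S : Fin l → Bool
    S k = ⌊ k Fin.≟ z ⌋
    vanishes : ∀ {q} → q ∈ ps → ∀ k → + q ∣ᶻ mask S v k
    vanishes {q} q∈ps k = ∣-mask S v λ k∈S → subst (λ k → + q ∣ᶻ v k) (sym (toWitness {a? = k Fin.≟ z} k∈S))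
      (off-p′ {λ q → + q ∣ᶻ v z} (lonely _) p′∣ q∈ps)

  -- Away from `p′` both terms vanish, so the characters at `q₁` are free and only `p′` imposes a
  -- condition. There either one term is 0, and is a zero-sum alone, or two nonzero terms satisfy
  -- `NotOne`.
  pair : ∀ {y z} → y ≢ z → Only-p′ y → Only-p′ z → HasSolvable
  pair {y} {z} y≢z lonely-y lonely-z with + p′ ∣? v y | + p′ ∣? v z
  ... | yes d | _ = singleton lonely-y d
  ... | no _ | yes d = singleton lonely-z d
  ... | no p′∤y | no p′∤z = S , (y , y∈S) ,
    solvable-none (off-p′ (λ q∈ps q≢p′ → NotOne-none (vanishes q∈ps q≢p′))
        (NotOne-two y≢z (∤-mask S v y∈S p′∤y) (∤-mask S v z∈S p′∤z)))
      q₁∈ps q₁≢p′ (vanishes q₁∈ps q₁≢p′)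
    where
    S? : ∀ k → Dec (k ≡ y ⊎ k ≡ z)
    S? k = (k Fin.≟ y) ⊎-dec (k Fin.≟ z)
    S : Fin l → Bool
    S k = ⌊ S? k ⌋
    y∈S : Bool.T (S y)
    y∈S = fromWitness {a? = S? y} (inj₁ refl)
    z∈S : Bool.T (S z)
    z∈S = fromWitness {a? = S? z} (inj₂ refl)
    vanishes : ∀ {q} → q ∈ ps → q ≢ p′ → ∀ k → + q ∣ᶻ mask S v k
    vanishes {q} q∈ps q≢p′ k = ∣-mask S v λ k∈S →
      [ (λ { refl → lonely-y q q∈ps q≢p′ }) , (λ { refl → lonely-z q q∈ps q≢p′ }) ]′ (toWitness {a? = S? k} k∈S)

  module _ {i j} (i≢j : i ≢ j)
           (vᵢ : ∀ {q} → q ∈ ps → q ≢ p′ → ¬ + q ∣ᶻ v i) (vⱼ : ∀ {q} → q ∈ ps → q ≢ p′ → ¬ + q ∣ᶻ v j) where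

    -- `i` and `j` alone guarantee `NotOne` at every prime other than `p′`, so after enlarging `S`
    -- only `p′` has to be checked. The term `z` is the third nonzero one at some `q` ≠ `p′`, where
    -- all characters become free.
    superset : ∀ S → Bool.T (S i) → Bool.T (S j) → NotOne p′ (mask S v) →
               ∀ {z} → z ≢ i → z ≢ j → Bool.T (S z) → ∀ {q} → q ∈ ps → q ≢ p′ → ¬ + q ∣ᶻ v z → HasSolvable
    superset S i∈S j∈S not-one z≢i z≢j z∈S q∈ps q≢p′ vz = S , (i , i∈S) ,
      solvable-three
        (off-p′ (λ q∈ps q≢p′ → NotOne-two i≢j (∤-mask S v i∈S (vᵢ q∈ps q≢p′)) (∤-mask S v j∈S (vⱼ q∈ps q≢p′))) not-one)
        q∈ps q≢p′ i≢j (z≢i ∘ sym) (z≢j ∘ sym)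
        (∤-mask S v i∈S (vᵢ q∈ps q≢p′)) (∤-mask S v j∈S (vⱼ q∈ps q≢p′)) (∤-mask S v z∈S vz)

    -- Two terms besides `i` and `j` are needed. If one of them is nonzero at some `q` ≠ `p′` it
    -- serves as the third term; if neither is, the two form a `pair`.
    from-whole : NotOne p′ v → HasSolvable
    from-whole not-one =
      let y , y≢i , y≢j , _ = fresh 3<l i j j
          z , z≢i , z≢j , z≢y = fresh 3<l i j y
      in [ (λ (q , q∈ps , q≢p′ , vy) → superset (const true) tt tt not-one y≢i y≢j tt q∈ps q≢p′ vy)
         , (λ lonely-y →
             [ (λ (q , q∈ps , q≢p′ , vz) → superset (const true) tt tt not-one z≢i z≢j tt q∈ps q≢p′ vz)
             , (λ lonely-z → pair z≢y lonely-z lonely-y)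
             ]′ (only-p′? z))
         ]′ (only-p′? y)

    -- Once `m` is left out, `p′` divides every term and imposes nothing. A term outside `i`, `j`,
    -- `m` is either a third nonzero one at some `q` ≠ `p′` or 0 modulo every prime, thus a zero-sum
    -- by itself.
    from-complement : ∀ {m} → m ≢ i → m ≢ j → (∀ k → k ≢ m → + p′ ∣ᶻ v k) → HasSolvable
    from-complement {m} m≢i m≢j off =
      let z , z≢i , z≢j , z≢m = fresh 3<l i j m
      in [ (λ (q , q∈ps , q≢p′ , vz) → superset S (∈S (m≢i ∘ sym)) (∈S (m≢j ∘ sym))
               (NotOne-none λ k → ∣-mask S v λ k∈S → off k (toWitness {a? = S? k} k∈S))
               z≢i z≢j (∈S z≢m) q∈ps q≢p′ vz)
         , (λ lonely-z → singleton lonely-z (off z z≢m))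
         ]′ (only-p′? z)
      where
      S? : ∀ k → Dec (k ≢ m)
      S? k = ¬? (k Fin.≟ m)
      S : Fin l → Bool
      S k = ⌊ S? k ⌋
      ∈S : ∀ {k} → k ≢ m → Bool.T (S k)
      ∈S {k} k≢m = fromWitness {a? = S? k} k≢m

    -- If p′ divides every term but the m-th, then m ∉ S, and S can be enlarged to
    -- the complement of m; otherwise to the whole sequence.
    from-pair : ∀ S → Bool.T (S i) → Bool.T (S j) → NotOne p′ (mask S v) → HasSolvable
    from-pair S i∈S j∈S not-one with any? (λ m → ¬? (+ p′ ∣? v m) ×-dec Fin.all? (λ k → ¬? (¬? (k Fin.≟ m) ×-dec ¬? (+ p′ ∣? v k))))
    ... | no ∄ = from-whole λ m vm → decidable-stable
      (any? λ k → ¬? (k Fin.≟ m) ×-dec ¬? (+ p′ ∣? v k)) λ ∄k → ∄ (m , vm , λ k p → ∄k (k , p))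
    ... | yes (m , vm , off) = from-complement (m∉S i∈S) (m∉S j∈S)
      λ k k≢m → decidable-stable (+ p′ ∣? v k) λ vk → off k (k≢m , vk)
      where
      m∉S : ∀ {k} → Bool.T (S k) → m ≢ k
      m∉S m∈S refl =
        let k , k≢m , uk = not-one m (∤-mask S v m∈S vm)
        in off k (k≢m , proj₂ (∤-unmask S v uk))

  -- The single prime `q₁` serves as a probe. If it sees exactly the terms `i` and `j`, a prime `q`
  -- ≠ `p′` dividing one of them frees the weight of that term, and `solvable-two` applies with this
  -- term in the role of its `j`. Otherwise both are nonzero at all `q` ≠ `p′`, and the subsequence
  -- may have to be exchanged.
  solve : ∀ S → (∃[ i ] Bool.T (S i)) → (∀ {q} → q ∈ ps → NotOne q (mask S v)) → HasSolvable
  solve S nonempty not-one with support-count (prime q₁∈ps) (7≤ q₁∈ps) (mask S v)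
  ... | none off = S , nonempty , solvable-none not-one q₁∈ps q₁≢p′
          (λ i → ∣-stable (prime q₁∈ps) (7≤ q₁∈ps) (mask S v) (off i))
  ... | one i uᵢ off = let j , j≢i , uⱼ = not-one q₁∈ps i uᵢ in contradiction uⱼ (off j j≢i)
  ... | three i j k i≢j i≢k j≢k uᵢ uⱼ uₖ = S , nonempty ,
          solvable-three not-one q₁∈ps q₁≢p′ i≢j i≢k j≢k uᵢ uⱼ uₖ
  ... | two i j i≢j uᵢ uⱼ off =
    [ (λ (q , q∈ps , q≢p′ , q∣uᵢ) → S , nonempty , solvable-two not-one q₁∈ps q₁≢p′ q∈ps q≢p′
          (i≢j ∘ sym) uⱼ uᵢ (λ k k≢j k≢i → off′ k k≢i k≢j) q∣uᵢ)
    , (λ noneᵢ →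
        [ (λ (q , q∈ps , q≢p′ , q∣uⱼ) → S , nonempty , solvable-two not-one q₁∈ps q₁≢p′ q∈ps q≢p′
              i≢j uᵢ uⱼ off′ q∣uⱼ)
        , (λ noneⱼ → from-pair i≢j
            (λ q∈ps q≢p′ → proj₂ (∤-unmask S v λ d → noneᵢ q∈ps (q≢p′ , d)))
            (λ q∈ps q≢p′ → proj₂ (∤-unmask S v λ d → noneⱼ q∈ps (q≢p′ , d)))
            S (proj₁ (∤-unmask S v uᵢ)) (proj₁ (∤-unmask S v uⱼ)) (not-one p′∈ps))
        ]′ (search (λ q → ¬? (q ℕ.≟ p′) ×-dec (+ q ∣? mask S v j)) ps))
    ]′ (search (λ q → ¬? (q ℕ.≟ p′) ×-dec (+ q ∣? mask S v i)) ps)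
    where
    off′ : ∀ k → k ≢ i → k ≢ j → + q₁ ∣ᶻ mask S v k
    off′ k k≢i k≢j = ∣-stable (prime q₁∈ps) (7≤ q₁∈ps) (mask S v) (off k k≢i k≢j)

-- The ring ℤ/n

abs-- : ∀ m n → abs (+ m - + n) ≡ ℕ.∣ m - n ∣
abs-- zero    zero    = refl
abs-- zero    (suc n) = refl
abs-- (suc m) zero    = cong suc (ℕ.+-identityʳ m)
abs-- (suc m) (suc n) = begin
  abs (+ suc m - + suc n)   ≡⟨ cong abs (ℤ.[+m]-[+n]≡m⊖n (suc m) (suc n)) ⟩
  abs (suc m ℤ.⊖ suc n)     ≡⟨ cong abs (ℤ.[1+m]⊖[1+n]≡m⊖n m n) ⟩
  abs (m ℤ.⊖ n)             ≡⟨ cong abs (ℤ.[+m]-[+n]≡m⊖n m n) ⟨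
  abs (+ m - + n)           ≡⟨ abs-- m n ⟩
  ℕ.∣ m - n ∣               ∎
  where open ≡-Reasoning

mod-≅ : ∀ m n .{{_ : NonZero n}} → + toℕ (m mod n) ≅ + m [ n ]
mod-≅ m n = residue-≅ n (+ m)

≅-∣ : ∀ {q n x y} → q ∣ n → x ≅ y [ n ] → x ≅ y [ q ]
≅-∣ q∣n (cong-mod d) = cong-mod (∣-trans (∣ᵤ⇒∣ q∣n) d)

module _ {q : ℕ} (pr : Prime q) (7≤q : 7 ≤ q) where

  open Quadratic pr 7≤q

  private instance
    q≢0 : NonZero q
    q≢0 = prime⇒nonZero pr

  IsSquareMod⇒Square : ∀ {a} → IsSquareMod q a → Square (+ a)
  IsSquareMod⇒Square {a} (x , d) = + toℕ x , cong-mod (subst (λ y → + q ∣ᶻ y - + a) (ℤ.pos-* (toℕ x) (toℕ x))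
    (∣ᵤ⇒∣ (subst (q ℕ.∣_) (sym (abs-- (toℕ x ℕ.* toℕ x) a)) d)))

  Square⇒IsSquareMod : ∀ {a} → Square (+ a) → IsSquareMod q a
  Square⇒IsSquareMod {a} (y , e) = x , subst (q ℕ.∣_) (abs-- (toℕ x ℕ.* toℕ x) a)
    (∣⇒∣ᵤ (subst (λ z → + q ∣ᶻ z - + a) (sym (ℤ.pos-* (toℕ x) (toℕ x)))
      (∣-difference (≅-trans (≅-* (residue-≅ q y) (residue-≅ q y)) e))))
    where
    x : Fin q
    x = residue q y

  legendre-unit : ∀ {a b} → ¬ + q ∣ᶻ + a → does (isSquareMod? q a) ≡ b → legendre a q ≡ (if b then 1ℤ else -1ℤ)
  legendre-unit {a} ¬d eq = trans
    (cong (λ c → if c then 0ℤ else (if does (isSquareMod? q a) then 1ℤ else -1ℤ)) (dec-false (q ℕ.∣? a) (¬d ∘ ∣ᵤ⇒∣)))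
    (cong (λ c → if c then 1ℤ else -1ℤ) eq)

  legendre-sign : ∀ s {a} → HasSign s (+ a) → legendre a q ≡ s ℤ.◃ 1
  legendre-sign Sign.+ {a} (¬d , sq) = legendre-unit ¬d (dec-true (isSquareMod? q a) (Square⇒IsSquareMod sq))
  legendre-sign Sign.- {a} (¬d , ¬sq) = legendre-unit ¬d (dec-false (isSquareMod? q a) (¬sq ∘ IsSquareMod⇒Square))

-- Jacobi symbols as products of signs, and Chinese remainders

legendre-∏ : ∀ {a} σ ps → (∀ {q} → q ∈ ps → legendre a q ≡ σ q ℤ.◃ 1) →
             foldr _*_ 1ℤ (map (legendre a) ps) ≡ ∏ σ ps ℤ.◃ 1
legendre-∏ σ [] e = refl
legendre-∏ σ (p ∷ ps) e = trans (cong₂ _*_ (e (here refl)) (legendre-∏ σ ps (e ∘ there)))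
  (sym (ℤ.◃-distrib-* (σ p) (∏ σ ps) 1 1))

coprime-product : ∀ {p ps} → Prime p → All Prime ps → All (p ≢_) ps → Coprime (product ps) p
coprime-product pr prs p∉ps = ∤⇒coprime pr λ d →
  All.lookup p∉ps (factorisationHasAllPrimeFactors pr d prs) refl

-- The correction `P * a * (f p - x)` vanishes modulo the primes already treated, since they divide
-- `P`, and is f p - x modulo `p`, since `P * a` ≅ 1 there.
chinese-remainder : ∀ {ps} → All Prime ps → Unique ps → (f : ℕ → ℤ) →
                    ∃[ x ] (∀ {q} → q ∈ ps → x ≅ f q [ q ])
chinese-remainder [] [] f = 0ℤ , λ ()
chinese-remainder {p ∷ ps} (pr ∷ prs) (p∉ps ∷ uniq) f = extend (chinese-remainder prs uniq f)
  where
  P : ℤ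
  P = + product ps
  a : ℤ
  a = proj₁ (bézoutℤ (coprime-product pr prs p∉ps))
  Pa≅1 : P * a ≅ 1ℤ [ p ]
  Pa≅1 = proj₂ (bézoutℤ (coprime-product pr prs p∉ps))
  at-p : ∀ P a x y → P * a ≅ 1ℤ [ p ] → x + P * a * (y - x) ≅ y [ p ]
  at-p P a x y e = begin
    x + P * a * (y - x)   ≈⟨ ≅-+ (≅-reflexive {x = x} refl) (≅-* e (≅-reflexive {x = y - x} refl)) ⟩
    x + 1ℤ * (y - x)      ≡⟨ ring y x ⟩
    y                     ∎
    where
    open SetoidReasoning (≅-setoid p)
    ring : ∀ y x → x + 1ℤ * (y - x) ≡ y
    ring = solve-∀
  off-p : ∀ {q} P a x y → + q ∣ᶻ P → x + P * a * (y - x) ≅ x [ q ]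
  off-p P a x y d = ≅-by (ring x P a y) (∣m⇒∣m*n (a * (y - x)) d)
    where
    ring : ∀ x P a y → P * (a * (y - x)) ≡ x + P * a * (y - x) - x
    ring = solve-∀
  extend : ∃[ x ] (∀ {q} → q ∈ ps → x ≅ f q [ q ]) → ∃[ x ] (∀ {q} → q ∈ p ∷ ps → x ≅ f q [ q ])
  extend (x , hx) = x + P * a * (f p - x) , λ
    { (here refl) → at-p P a x (f p) Pa≅1
    ; (there q∈ps) → ≅-trans (off-p P a x (f p) (∣ᵤ⇒∣ (∈⇒∣product q∈ps))) (hx q∈ps) }

∣-product : ∀ {ps} → All Prime ps → Unique ps → ∀ {z} → (∀ {q} → q ∈ ps → + q ∣ᶻ z) → + product ps ∣ᶻ z
∣-product [] [] _ = ∣ᵤ⇒∣ (ℕ.1∣ _)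
∣-product {p ∷ ps} (pr ∷ prs) (p∉ps ∷ uniq) {z} d = extend (∣-product prs uniq (d ∘ there))
  where
  P : ℤ
  P = + product ps
  ring : ∀ c p P → c * p * P ≡ c * (p * P)
  ring = solve-∀
  extend : P ∣ᶻ z → + (p ℕ.* product ps) ∣ᶻ z
  extend (divides c z≡cP) = recombine
    ([ id , (λ p∣P → contradiction refl (All.lookup p∉ps (factorisationHasAllPrimeFactors pr (∣⇒∣ᵤ p∣P) prs))) ]′
      (prime-∣* pr c P (∣-resp z≡cP (d (here refl)))))
    where
    recombine : + p ∣ᶻ c → + (p ℕ.* product ps) ∣ᶻ z
    recombine (divides e c≡ep) = divides e (begin
      z                             ≡⟨ z≡cP ⟩
      c * P                         ≡⟨ cong (_* P) c≡ep ⟩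
      e * + p * P                   ≡⟨ ring e (+ p) P ⟩
      e * (+ p * P)                 ≡⟨ cong (e *_) (ℤ.pos-* p (product ps)) ⟨
      e * + (p ℕ.* product ps)      ∎)
      where open ≡-Reasoning

squarefree⇒unique : ∀ {ps} → All Prime ps → Squarefree (product ps) → Unique ps
squarefree⇒unique [] _ = []
squarefree⇒unique {p ∷ ps} (pr ∷ prs) sf =
  All.tabulate (λ { q∈ps refl → contradiction (subst Prime (sf p (ℕ.*-monoʳ-∣ p (∈⇒∣product q∈ps))) pr) ¬prime[1] })
  ∷ squarefree⇒unique prs (λ d d²∣ → sf d (ℕ.∣n⇒∣m*n p d²∣))

-- Subsequences and their weights as functions on positions

module _ {n : ℕ} .{{_ : NonZero n}} where

  values : (T : List (Fin n)) → Vector ℤ (length T)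
  values T i = + toℕ (lookup T i)

  weightedSum-∷ : ∀ a y as ys → + toℕ (weightedSum (a ∷ as) (y ∷ ys)) ≅
                  + toℕ a * + toℕ y + + toℕ (weightedSum as ys) [ n ]
  weightedSum-∷ a y as ys = begin
    + toℕ (weightedSum (a ∷ as) (y ∷ ys))
      ≈⟨ mod-≅ (toℕ (a ⊗ y) ℕ.+ toℕ (weightedSum as ys)) n ⟩
    + (toℕ (a ⊗ y) ℕ.+ toℕ (weightedSum as ys))
      ≡⟨ ℤ.pos-+ (toℕ (a ⊗ y)) _ ⟩
    + toℕ (a ⊗ y) + + toℕ (weightedSum as ys)
      ≈⟨ ≅-+ (mod-≅ (toℕ a ℕ.* toℕ y) n) (≅-reflexive {x = + toℕ (weightedSum as ys)} refl) ⟩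
    + (toℕ a ℕ.* toℕ y) + + toℕ (weightedSum as ys)
      ≡⟨ cong (_+ + toℕ (weightedSum as ys)) (ℤ.pos-* (toℕ a) (toℕ y)) ⟩
    + toℕ a * + toℕ y + + toℕ (weightedSum as ys)
      ∎
    where open SetoidReasoning (≅-setoid n)

  pick : ∀ {A : Set} (T : List (Fin n)) → (Fin (length T) → Bool) → (Fin (length T) → A) → List A
  pick [] S b = []
  pick (x ∷ T) S b = if S zero then b zero ∷ pick T (S ∘ suc) (b ∘ suc) else pick T (S ∘ suc) (b ∘ suc)

  pick-⊆ : ∀ T S → pick T S (lookup T) ⊆ T
  pick-⊆ [] S = []
  pick-⊆ (x ∷ T) S with S zero
  ... | true = refl ∷ pick-⊆ T (S ∘ suc)
  ... | false = x ∷ʳ pick-⊆ T (S ∘ suc)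

  pick-length : ∀ {A B : Set} T S (b : _ → A) (c : _ → B) → length (pick T S b) ≡ length (pick T S c)
  pick-length [] S b c = refl
  pick-length (x ∷ T) S b c with S zero
  ... | true = cong suc (pick-length T (S ∘ suc) (b ∘ suc) (c ∘ suc))
  ... | false = pick-length T (S ∘ suc) (b ∘ suc) (c ∘ suc)

  pick-All : ∀ {A : Set} {P : A → Set} T S (b : _ → A) → (∀ i → P (b i)) → All P (pick T S b)
  pick-All [] S b p = []
  pick-All (x ∷ T) S b p with S zero
  ... | true = p zero ∷ pick-All T (S ∘ suc) (b ∘ suc) (p ∘ suc)
  ... | false = pick-All T (S ∘ suc) (b ∘ suc) (p ∘ suc)

  pick-nonempty : ∀ {A : Set} T S (b : _ → A) i → Bool.T (S i) → pick T S b ≢ []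
  pick-nonempty (x ∷ T) S b i i∈S with S zero in eq
  ... | true = λ ()
  pick-nonempty (x ∷ T) S b zero i∈S | false = contradiction (subst Bool.T eq i∈S) λ ()
  pick-nonempty (x ∷ T) S b (suc i) i∈S | false = pick-nonempty T (S ∘ suc) (b ∘ suc) i i∈S

  pick-sum : ∀ T S (a : Fin (length T) → Fin n) →
             + toℕ (weightedSum (pick T S a) (pick T S (lookup T))) ≅
             (λ i → + toℕ (a i)) ∙ mask S (values T) [ n ]
  pick-sum [] S a = mod-≅ 0 n
  pick-sum (x ∷ T) S a with S zero
  ... | true = ≅-trans (weightedSum-∷ (a zero) x (pick T (S ∘ suc) (a ∘ suc)) (pick T (S ∘ suc) (lookup T)))
                 (≅-+ (≅-reflexive {x = + toℕ (a zero) * + toℕ x} refl) (pick-sum T (S ∘ suc) (a ∘ suc)))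
  ... | false = ≅-trans (pick-sum T (S ∘ suc) (a ∘ suc)) (≅-reflexive
                  (sym (trans (cong (_+ rest) (ℤ.*-zeroʳ (+ toℕ (a zero)))) (ℤ.+-identityˡ rest))))
    where
    rest : ℤ
    rest = (λ i → + toℕ (a (suc i))) ∙ mask (S ∘ suc) (values T)

  ∣⇒≡𝟘 : ∀ {x : Fin n} → + n ∣ᶻ + toℕ x → x ≡ 𝟘
  ∣⇒≡𝟘 d = toℕ-≅⇒≡ (≅-trans (∣⇒≅0 d) (≅-sym (mod-≅ 0 n)))

  -- Turns a sublist with its list of weights into functions on the positions of `T`. Off `S` the
  -- weight is a filler, so `weights` speaks of selected positions only; the mask removes the filler
  -- from the sum.
  record Selection (A : Pred (Fin n) 0ℓ) (T : List (Fin n)) (ys as : List (Fin n)) : Set where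
    field
      S        : Fin (length T) → Bool
      a        : Fin (length T) → Fin n
      weights  : ∀ i → Bool.T (S i) → A (a i)
      total    : + toℕ (weightedSum as ys) ≅ (λ i → + toℕ (a i)) ∙ mask S (values T) [ n ]
      nonempty : ys ≢ [] → ∃[ i ] Bool.T (S i)

  selection : ∀ {A ys T as} → ys ⊆ T → length as ≡ length ys → All A as → Selection A T ys as
  selection {as = []} [] _ _ = record
    { S = λ () ; a = λ () ; weights = λ () ; total = mod-≅ 0 n ; nonempty = λ ≢[] → contradiction refl ≢[] }
  selection {T = y ∷ T} (y ∷ʳ ys⊆T) eq all = record
    { S = λ { zero → false ; (suc i) → S i }
    ; a = λ { zero → 𝟘 ; (suc i) → a i }
    ; weights = λ { (suc i) → weights i }
    ; total = ≅-trans total (≅-reflexive (sym (trans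
        (cong (_+ (λ i → + toℕ (a i)) ∙ mask S (values T)) (ℤ.*-zeroʳ (+ toℕ (𝟘 {n})))) (ℤ.+-identityˡ _))))
    ; nonempty = λ ≢[] → let i , i∈S = nonempty ≢[] in suc i , i∈S }
    where open Selection (selection ys⊆T eq all)
  selection {ys = y ∷ ys} {as = a₀ ∷ as} (refl ∷ ys⊆T) eq (p ∷ all) = record
    { S = λ { zero → true ; (suc i) → S i }
    ; a = λ { zero → a₀ ; (suc i) → a i }
    ; weights = λ { zero _ → p ; (suc i) → weights i }
    ; total = ≅-trans (weightedSum-∷ a₀ y as ys) (≅-+ (≅-reflexive {x = + toℕ a₀ * + toℕ y} refl) total)
    ; nonempty = λ _ → zero , tt }
    where open Selection (selection ys⊆T (ℕ.suc-injective eq) all)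

  module _ {A : Pred (Fin n) 0ℓ} {T : List (Fin n)} where

    zero-sum-from-weights : ∀ S → (∃[ i ] Bool.T (S i)) → (a : Fin (length T) → Fin n) → (∀ i → A (a i)) →
                            + n ∣ᶻ (λ i → + toℕ (a i)) ∙ mask S (values T) → HasZeroSumSubsequence A T
    zero-sum-from-weights S (i , i∈S) a all d =
      pick T S (lookup T) , pick-⊆ T S , pick-nonempty T S (lookup T) i i∈S ,
      pick T S a , pick-length T S a (lookup T) , pick-All T S a all ,
      ∣⇒≡𝟘 (∣-cong (pick-sum T S a) d)

    weights-from-zero-sum : HasZeroSumSubsequence A T →
      ∃[ S ] (∃[ i ] Bool.T (S i)) × ∃[ a ] (∀ i → Bool.T (S i) → A (a i)) ×
      + n ∣ᶻ (λ i → + toℕ (a i)) ∙ mask S (values T)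
    weights-from-zero-sum (ys , ys⊆T , ≢[] , as , eq , all , sum≡𝟘) =
      S , nonempty ≢[] , a , weights ,
      ∣-cong (≅-sym total) (subst (λ x → + n ∣ᶻ + toℕ x) (sym sum≡𝟘) (≅0⇒∣ (mod-≅ 0 n)))
      where open Selection (selection {A} {T = T} ys⊆T eq all)

  -- Comparing the extremal sequences of two weight sets

  HasZeroSum-mono : ∀ {A B : Pred (Fin n) 0ℓ} {T} → (∀ {a} → A a → B a) →
                    HasZeroSumSubsequence A T → HasZeroSumSubsequence B T
  HasZeroSum-mono A⊆B (ys , ys⊆T , ≢[] , as , eq , all , sum≡𝟘) =
    ys , ys⊆T , ≢[] , as , eq , All.map A⊆B all , sum≡𝟘

  EveryHasZeroSum-≤ : ∀ {A : Pred (Fin n) 0ℓ} {j k} → j ≤ k → EveryHasZeroSum A j → EveryHasZeroSum A k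
  EveryHasZeroSum-≤ {j = j} j≤k every T refl =
    let ys , ys⊆ , zs = every (take j T) (trans (length-take j T) (ℕ.m≤n⇒m⊓n≡m j≤k))
    in ys , ⊆-trans ys⊆ (take-⊆ j T) , zs

  -- For k above `m`, `EveryHasZeroSum` means the same for `A` and `B`, and by `large` every k
  -- satisfying it is above `m`; so the least such k agree, whatever their value. The inequality
  -- `m < k` is strict because an extremal sequence has length k - 1, and `B⇒A` must still apply to
  -- it.
  extremal-⇔ : ∀ {A B : Pred (Fin n) 0ℓ} m → (∀ {a} → A a → B a) →
               (∀ T → m ≤ length T → HasZeroSumSubsequence B T → HasZeroSumSubsequence A T) →
               (∀ k → 1 ≤ k → EveryHasZeroSum B k → m < k) →
               ∀ T → IsDExtremal A T ⇔ IsDExtremal B T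
  extremal-⇔ {A} {B} m A⊆B B⇒A large T = mk⇔
    (λ (k , dav , len , ¬zs) → k , to-B dav , len ,
      ¬zs ∘ B⇒A T (length≥m len (large k (positive dav) (every-B (forces dav)))))
    (λ (k , dav , len , ¬zs) → k , to-A dav , len , ¬zs ∘ HasZeroSum-mono A⊆B)
    where
    open IsDavenportConstant
    every-B : ∀ {k} → EveryHasZeroSum A k → EveryHasZeroSum B k
    every-B every T len = HasZeroSum-mono A⊆B (every T len)
    every-A : ∀ {k} → 1 ≤ k → EveryHasZeroSum B k → EveryHasZeroSum A k
    every-A {k} 1≤k every T refl = B⇒A T (ℕ.<⇒≤ (large k 1≤k every)) (every T refl)
    length≥m : ∀ {k} → length T ≡ k ℕ.∸ 1 → m < k → m ≤ length T
    length≥m {suc k} len (s≤s m≤k) = subst (m ≤_) (sym len) m≤k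
    to-B : ∀ {k} → IsDavenportConstant A k → IsDavenportConstant B k
    to-B dav = record
      { positive = positive dav
      ; forces = every-B (forces dav)
      ; least = λ j 1≤j every → least dav j 1≤j (every-A 1≤j every) }
    to-A : ∀ {k} → IsDavenportConstant B k → IsDavenportConstant A k
    to-A dav = record
      { positive = positive dav
      ; forces = every-A (positive dav) (forces dav)
      ; least = λ j 1≤j every → least dav j 1≤j (every-B every) }

lookup-injective : ∀ {A : Set} {xs : List A} → Unique xs → ∀ i j → lookup xs i ≡ lookup xs j → i ≡ j
lookup-injective (x∉xs ∷ uniq) zero zero _ = refl
lookup-injective {xs = _ ∷ xs} (x∉xs ∷ uniq) zero (suc j) e = contradiction e (All.lookup x∉xs (∈-lookup {xs = xs} j))
lookup-injective {xs = _ ∷ xs} (x∉xs ∷ uniq) (suc i) zero e = contradiction (sym e) (All.lookup x∉xs (∈-lookup {xs = xs} i))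
lookup-injective (x∉xs ∷ uniq) (suc i) (suc j) e = cong suc (lookup-injective uniq i j e)

-- The primes of n put together

module Main (n : ℕ) .{{_ : NonZero n}} (squarefree : Squarefree n)
            (7≤primes : ∀ p → Prime p → p ∣ n → 7 ≤ p) where

  ps : List ℕ
  ps = factors (factorise n)

  n≡product : n ≡ product ps
  n≡product = PrimeFactorisation.isFactorisation (factorise n)

  primes : All Prime ps
  primes = PrimeFactorisation.factorsPrime (factorise n)

  ∈⇒prime : ∀ {q} → q ∈ ps → Prime q
  ∈⇒prime = All.lookup primes

  ∈⇒∣n : ∀ {q} → q ∈ ps → q ∣ n
  ∈⇒∣n {q} q∈ps = subst (q ℕ.∣_) (sym n≡product) (∈⇒∣product q∈ps)

  ∈⇒7≤ : ∀ {q} → q ∈ ps → 7 ≤ q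
  ∈⇒7≤ q∈ps = 7≤primes _ (∈⇒prime q∈ps) (∈⇒∣n q∈ps)

  unique : Unique ps
  unique = squarefree⇒unique primes (subst Squarefree n≡product squarefree)

  prime∣n⇒∈ : ∀ {p} → Prime p → p ∣ n → p ∈ ps
  prime∣n⇒∈ {p} pr p∣n = factorisationHasAllPrimeFactors pr (subst (p ℕ.∣_) n≡product p∣n) primes

  ∣n : ∀ {z} → (∀ {q} → q ∈ ps → + q ∣ᶻ z) → + n ∣ᶻ z
  ∣n {z} d = subst (λ m → + m ∣ᶻ z) (sym n≡product) (∣-product primes unique d)

  realise : ∀ f → ∃[ a ] (∀ {q} → q ∈ ps → + toℕ {n} a ≅ f q [ q ])
  realise f =
    let x , hx = chinese-remainder primes unique f
    in residue n x , λ q∈ps → ≅-trans (≅-∣ (∈⇒∣n q∈ps) (residue-≅ n x)) (hx q∈ps)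

  ⊗-≅ : ∀ (a b : Fin n) → + toℕ (a ⊗ b) ≅ + toℕ a * + toℕ b [ n ]
  ⊗-≅ a b = ≅-trans (mod-≅ (toℕ a ℕ.* toℕ b) n) (≅-reflexive (ℤ.pos-* (toℕ a) (toℕ b)))

  unit⇒∤ : ∀ {a q} → U n a → q ∈ ps → ¬ + q ∣ᶻ + toℕ a
  unit⇒∤ {a} (b , _ , ab≡𝟙) q∈ps d = ∤1 (∈⇒prime q∈ps)
    (∣-cong (≅-∣ (∈⇒∣n q∈ps) (≅-sym ab≅1)) (∣m⇒∣m*n (+ toℕ b) d))
    where
    ab≅1 : + toℕ a * + toℕ b ≅ 1ℤ [ n ]
    ab≅1 = ≅-trans (≅-sym (⊗-≅ a b)) (subst (λ c → + toℕ c ≅ 1ℤ [ n ]) (sym ab≡𝟙) (mod-≅ 1 n))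

  ∤⇒unit : ∀ {a} → (∀ {q} → q ∈ ps → ¬ + q ∣ᶻ + toℕ a) → U n a
  ∤⇒unit {a} a-unit =
    let f , inv = choice ps 0ℤ (λ q x → + toℕ a * x ≅ 1ℤ [ q ])
          λ q∈ps → let y , _ , e = inverse (∈⇒prime q∈ps) (a-unit q∈ps) in y , e
        b , hb = realise f
        ab≡𝟙 = toℕ-≅⇒≡ (≅-trans (⊗-≅ a b) (≅-trans
          (cong-mod (∣n λ q∈ps → ∣-difference (≅-trans (≅-* (≅-reflexive {x = + toℕ a} refl) (hb q∈ps)) (inv q∈ps))))
          (≅-sym (mod-≅ 1 n))))
    in b , trans (cong (_mod n) (ℕ.*-comm (toℕ b) (toℕ a))) ab≡𝟙 , ab≡𝟙

  -- The given unit weights are used only to obtain `NotOne` at each prime. The weights in L(n;p′)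
  -- are then built from scratch by Chinese remainders, possibly on a different subsequence.
  zero-sum-U⇒L : ∀ {p′ q₁} → p′ ∈ ps → q₁ ∈ ps → q₁ ≢ p′ → ∀ T → 4 ≤ length T →
                 HasZeroSumSubsequence (U n) T → HasZeroSumSubsequence (L n p′) T
  zero-sum-U⇒L {p′} p′∈ps q₁∈ps q₁≢p′ T 4≤ zs =
    let S , nonempty , a , units , d = weights-from-zero-sum zs
    in realised (solve S nonempty λ {q} q∈ps →
         zero-sum⇒NotOne (∈⇒prime q∈ps) (∈⇒7≤ q∈ps) (mask S (values T)) (λ i → + toℕ (a i))
           (λ i uᵢ → unit⇒∤ (units i (proj₁ (∤-unmask S (values T) uᵢ))) q∈ps)
           (∣-trans (∣ᵤ⇒∣ (∈⇒∣n q∈ps)) d))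
    where
    open Combinatorial ps ∈⇒prime ∈⇒7≤ unique p′∈ps q₁∈ps q₁≢p′ 4≤ (values T)
    realised : HasSolvable → HasZeroSumSubsequence (L n p′) T
    realised (S , nonempty , f , sol , bal) = zero-sum-from-weights S nonempty a a∈L
      (∣n λ {q} q∈ps → ∣-cong (∙-congˡ (mask S (values T)) (λ i → a-≅ i q∈ps)) (proj₂ (sol q∈ps)))
      where
      a : Fin (length T) → Fin n
      a i = proj₁ (realise (λ q → proj₂ (f q) i))
      a-≅ : ∀ i {q} → q ∈ ps → + toℕ (a i) ≅ proj₂ (f q) i [ q ]
      a-≅ i = proj₂ (realise (λ q → proj₂ (f q) i))
      signs : ∀ i {q} → q ∈ ps → Residues.HasSign q (proj₁ (f q) i) (+ toℕ (a i))
      signs i {q} q∈ps = Quadratic.HasSign-cong (∈⇒prime q∈ps) (∈⇒7≤ q∈ps) (proj₁ (f q) i)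
        (≅-sym (a-≅ i q∈ps)) (proj₁ (sol q∈ps) i)
      symbol : ∀ i {q} → q ∈ ps → legendre (toℕ (a i)) q ≡ proj₁ (f q) i ℤ.◃ 1
      symbol i {q} q∈ps = legendre-sign (∈⇒prime q∈ps) (∈⇒7≤ q∈ps) (proj₁ (f q) i) (signs i q∈ps)
      a∈L : ∀ i → L n p′ (a i)
      a∈L i =
        ∤⇒unit (λ {q} q∈ps → Quadratic.HasSign⇒∤ (∈⇒prime q∈ps) (∈⇒7≤ q∈ps) (proj₁ (f q) i) (signs i q∈ps)) ,
        trans (legendre-∏ (λ q → proj₁ (f q) i) ps (symbol i))
          (trans (cong (ℤ._◃ 1) (bal i)) (sym (symbol i p′∈ps)))

  -- Modulo p i the idempotent of p i is the only nonzero one of the four terms, so a subsequence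
  -- containing it violates `NotOne` at p i.
  ¬EveryHasZeroSum-4 : ∀ {p₁ p₂ p₃ p₄ rest} → ps ≡ p₁ ∷ p₂ ∷ p₃ ∷ p₄ ∷ rest → ¬ EveryHasZeroSum (U n) 4
  ¬EveryHasZeroSum-4 {p₁} {p₂} {p₃} {p₄} {rest} eq every =
    let S , (i , i∈S) , a , units , d = weights-from-zero-sum {A = U n} {T = T} (every T refl)
        k , k≢i , uₖ = zero-sum⇒NotOne (∈⇒prime (p∈ps i)) (∈⇒7≤ (p∈ps i)) (mask S (values T)) (λ i → + toℕ (a i))
          (λ j uⱼ → unit⇒∤ (units j (proj₁ (∤-unmask S (values T) uⱼ))) (p∈ps i))
          (∣-trans (∣ᵤ⇒∣ (∈⇒∣n (p∈ps i))) d)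
          i (∤-mask S (values T) i∈S (diagonal i))
    in proj₂ (∤-unmask S (values T) uₖ) (off-diagonal k≢i)
    where
    δ : ℕ → ℕ → ℤ
    δ p q = if does (q ℕ.≟ p) then 1ℤ else 0ℤ
    idempotent : ℕ → Fin n
    idempotent p = proj₁ (realise (δ p))
    T : List (Fin n)
    T = idempotent p₁ ∷ idempotent p₂ ∷ idempotent p₃ ∷ idempotent p₄ ∷ []
    p : Fin 4 → ℕ
    p = lookup (p₁ ∷ p₂ ∷ p₃ ∷ p₄ ∷ [])
    T-lookup : ∀ i → lookup T i ≡ idempotent (p i)
    T-lookup zero = refl
    T-lookup (suc zero) = refl
    T-lookup (suc (suc zero)) = refl
    T-lookup (suc (suc (suc zero))) = refl
    p∈ps : ∀ i → p i ∈ ps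
    p∈ps i = subst (p i ∈_) (sym eq) (∈-++⁺ˡ (∈-lookup {xs = p₁ ∷ p₂ ∷ p₃ ∷ p₄ ∷ []} i))
    p-injective : ∀ {i j} → p i ≡ p j → i ≡ j
    p-injective {i} {j} = lookup-injective (take⁺ 4 (subst Unique eq unique)) i j
    value-≅ : ∀ i {q} → q ∈ ps → values T i ≅ δ (p i) q [ q ]
    value-≅ i {q} q∈ps = subst (λ x → + toℕ x ≅ δ (p i) q [ q ]) (sym (T-lookup i)) (proj₂ (realise (δ (p i))) q∈ps)
    diagonal : ∀ i → ¬ + p i ∣ᶻ values T i
    diagonal i = ∤-cong (∈⇒prime (p∈ps i)) (≅-sym (value-≅ i (p∈ps i)))
      (subst (λ b → ¬ + p i ∣ᶻ (if b then 1ℤ else 0ℤ)) (sym (dec-true (p i ℕ.≟ p i) refl)) (∤1 (∈⇒prime (p∈ps i))))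
    off-diagonal : ∀ {i k} → k ≢ i → + p i ∣ᶻ values T k
    off-diagonal {i} {k} k≢i = ∣-cong (value-≅ k (p∈ps i))
      (subst (λ b → + p i ∣ᶻ (if b then 1ℤ else 0ℤ)) (sym (dec-false (p i ℕ.≟ p k) (k≢i ∘ sym ∘ p-injective)))
        (divides 0ℤ refl))

U⇒L-prime : ∀ {n p} .{{_ : NonZero n}} → factors (factorise n) ≡ p ∷ [] → ∀ {a} → U n a → L n p a
U⇒L-prime {n} {p} eq {a} unit = unit ,
  trans (cong (foldr _*_ 1ℤ ∘ map (legendre (toℕ a))) eq) (ℤ.*-identityʳ (legendre (toℕ a) p))

theorem6p2 :
    (n : ℕ) .{{_ : NonZero n}} →
    Squarefree n →
    (∀ p → Prime p → p ∣ n → 7 ≤ p) →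
    (p′ : ℕ) → Prime p′ → p′ ∣ n →
    Ω n ≢ 2 → Ω n ≢ 3 →
    (T : List (ℤmod n)) → IsDExtremal (L n p′) T ⇔ IsDExtremal (U n) T
theorem6p2 n squarefree 7≤primes p′ p′-prime p′∣n Ω≢2 Ω≢3 = by-Ω ps refl
  where
  open Main n squarefree 7≤primes
  p′∈ps : p′ ∈ ps
  p′∈ps = prime∣n⇒∈ p′-prime p′∣n
  by-Ω : ∀ qs → ps ≡ qs → ∀ T → IsDExtremal (L n p′) T ⇔ IsDExtremal (U n) T
  by-Ω [] eq = contradiction (subst (p′ ∈_) eq p′∈ps) λ ()
  by-Ω (_ ∷ []) eq with subst (p′ ∈_) eq p′∈ps
  -- With a single prime the weight sets coincide, so sequences of every length transfer and the
  -- threshold is 0.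
  ... | here refl = extremal-⇔ 0 proj₁ (λ _ _ → HasZeroSum-mono (U⇒L-prime eq)) (λ _ 1≤k _ → 1≤k)
  by-Ω (_ ∷ _ ∷ []) eq = contradiction (cong length eq) Ω≢2
  by-Ω (_ ∷ _ ∷ _ ∷ []) eq = contradiction (cong length eq) Ω≢3
  by-Ω (p₁ ∷ p₂ ∷ _ ∷ _ ∷ _) eq =
    let q₁ , q₁∈ps , q₁≢p′ = other
    in extremal-⇔ 4 proj₁ (zero-sum-U⇒L p′∈ps q₁∈ps q₁≢p′)
         λ k _ every → ℕ.≰⇒> λ k≤4 → ¬EveryHasZeroSum-4 eq (EveryHasZeroSum-≤ k≤4 every)
    where
    other : ∃[ q ] q ∈ ps × q ≢ p′
    other with p₁ ℕ.≟ p′ | subst Unique eq unique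
    ... | no p₁≢p′ | _ = p₁ , subst (p₁ ∈_) (sym eq) (here refl) , p₁≢p′
    ... | yes p₁≡p′ | (p₁≢p₂ ∷ _) ∷ _ =
      p₂ , subst (p₂ ∈_) (sym eq) (there (here refl)) , λ p₂≡p′ → p₁≢p₂ (trans p₁≡p′ (sym p₂≡p′))
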